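{- There is an absolute constant $C$ such that for all positive integers $n$ and $k$ there is a CNF encoding of $\mathsf{AtMostK}(x_1,\dots,x_n)$ using at most $4n + C\sqrt[3]{kn^2}$ clauses and at most $C\sqrt[3]{kn^2}$ auxiliary variables (i.e. $4n + O(\sqrt[3]{kn^2})$ clauses and $O(\sqrt[3]{kn^2})$ auxiliary variables).
   Context: $\mathsf{AtMostK}(x_1,\dots,x_n)$ is true iff at most $k$ of $x_1,\dots,x_n$ are true. A CNF formula is a set of clauses; its size is its number of clauses. For a partial assignment $\tau$, $\varphi|_\tau$ deletes clauses satisfied by $\tau$ and literals falsified by $\tau$. A CNF $\varphi$ over $X\sqcup Y$, $X=(x_1,\dots,x_n)$, encodes $f$ if for every assignment $\tau$ of $X$, $f(\tau)=\top$ iff $\varphi|_\tau$ is satisfiable; variables in $Y$ are auxiliary. -}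

module Defs where

open import Data.Nat using (ℕ; zero; suc; _+_; _≤_)
open import Data.Bool using (Bool; true; false; not; if_then_else_)
open import Data.Fin using (Fin; zero; suc)
open import Data.Sum using (_⊎_; inj₁; inj₂)
open import Data.List using (List; []; _∷_; length)
open import Data.List.Relation.Unary.All using (All)
open import Data.List.Relation.Unary.Any using (Any)
open import Data.Product using (Σ)
open import Relation.Binary.PropositionalEquality using (_≡_)
open import Function.Bundles using (_⇔_)

data Lit (V : Set) : Set where
  pos : V → Lit V
  neg : V → Lit V

Clause : Set → Set
Clause V = List (Lit V)

CNF : Set → Set
CNF V = List (Clause V)

size : ∀ {V} → CNF V → ℕ
size = length

evalLit : ∀ {V} → (V → Bool) → Lit V → Bool
evalLit σ (pos v) = σ v
evalLit σ (neg v) = not (σ v)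

SatClause : ∀ {V} → (V → Bool) → Clause V → Set
SatClause σ C = Any (λ l → evalLit σ l ≡ true) C

SatCNF : ∀ {V} → (V → Bool) → CNF V → Set
SatCNF σ φ = All (SatClause σ) φ

Satisfiable : ∀ {V} → CNF V → Set
Satisfiable {V} φ = Σ (V → Bool) (λ σ → SatCNF σ φ)

-- Variables X ⊔ Y with X = Fin n (the inputs x₁..xₙ) and Y = Fin m (auxiliary).
Var : ℕ → ℕ → Set
Var n m = Fin n ⊎ Fin m

data Restricted (m : ℕ) : Set where
  satisfied : Restricted m
  remaining : Clause (Fin m) → Restricted m

restrictClause : ∀ {n m} → (Fin n → Bool) → Clause (Var n m) → Restricted m
restrictClause τ [] = remaining []
restrictClause τ (pos (inj₁ x) ∷ C) with τ x
... | true  = satisfied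
... | false = restrictClause τ C
restrictClause τ (neg (inj₁ x) ∷ C) with τ x
... | true  = restrictClause τ C
... | false = satisfied
restrictClause τ (pos (inj₂ y) ∷ C) with restrictClause τ C
... | satisfied   = satisfied
... | remaining D = remaining (pos y ∷ D)
restrictClause τ (neg (inj₂ y) ∷ C) with restrictClause τ C
... | satisfied   = satisfied
... | remaining D = remaining (neg y ∷ D)

restrict : ∀ {n m} → CNF (Var n m) → (Fin n → Bool) → CNF (Fin m)
restrict [] τ = []
restrict (C ∷ φ) τ with restrictClause τ C
... | satisfied   = restrict φ τ
... | remaining D = D ∷ restrict φ τ

countTrue : ∀ {n} → (Fin n → Bool) → ℕ
countTrue {zero}  τ = 0
countTrue {suc n} τ = (if τ zero then 1 else 0) + countTrue (λ i → τ (suc i))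

AtMostK : (k : ℕ) → ∀ {n} → (Fin n → Bool) → Set
AtMostK k τ = countTrue τ ≤ k

Encodes : ∀ {n m} → CNF (Var n m) → ((Fin n → Bool) → Set) → Set
Encodes {n} φ f = (τ : Fin n → Bool) → f τ ⇔ Satisfiable (restrict φ τ)

{-# OPTIONS --safe #-}
-- Split the n inputs into O(k b²) rows of length b, where b = ∛(n / k), and hash every row to three of O(k b)
-- places, each offering b slots. A nonempty row selects one of its places and copies its inputs into the
-- slots there: one clause per input for the selection and three for the copies. If no place is selected
-- twice, the number of true inputs is at most the number of filled slots, which a network of full adders
-- compares with k in O(k b²) clauses, and k b² = ∛(k n²). Conversely, at most k rows are nonempty, and by
-- Hall's theorem they have distinct places as soon as every set of at most k rows is hashed to at least as
-- many places. A first moment argument over sets V of v places and S of v + 1 rows gives such a hashing.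

module Submission where

open import Defs
open import Data.Bool using (Bool; true; false; not; if_then_else_; _∧_; _∨_; _xor_)
import Data.Bool.Properties as Bool
open import Data.Fin using (Fin; zero; suc; _↑ˡ_; _↑ʳ_; splitAt; inject≤; combine; quotient; remainder; _≟_)
open import Data.Fin.Patterns using (0F; 1F; 2F; 3F; 4F)
open import Data.Fin.Subset.Properties using (anySubset?)
open import Data.Fin.Properties
  using (any?; all?; suc-injective; inject≤-injective; splitAt-↑ˡ; splitAt-↑ʳ;
         combine-injective; remQuot-combine; combine-remQuot)
open import Data.List using (List; []; _∷_; _++_; map; length; tabulate; cartesianProduct)
open import Data.List.Membership.Propositional.Properties using (∈-cartesianProduct⁻)
open import Data.List.Properties using (map-++; length-map; length-++; length-tabulate)
open import Data.List.Relation.Unary.All as All using (All; []; _∷_)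
import Data.List.Relation.Unary.All.Properties as All
open import Data.List.Relation.Unary.Any as Any using (Any; here; there)
import Data.List.Relation.Unary.Any.Properties as Any
open import Data.Nat using (ℕ; zero; suc; _+_; _*_; _∸_; _^_; _≤_; _<_; z≤n; s≤s; NonZero; >-nonZero⁻¹; _≤?_; _<?_; _!; pred)
open import Data.Nat.ListAction using (sum)
open import Data.Nat.ListAction.Properties using (sum-++)
open import Data.Nat.Properties renaming (_≟_ to _≟ℕ_) hiding (suc-injective; _≤?_; _<?_)
open import Data.Nat.Solver using (module +-*-Solver)
open import Data.Product using (Σ; ∃; _×_; _,_; proj₁; proj₂)
open import Data.Sum using (_⊎_; inj₁; inj₂; [_,_]; map₂)
open import Data.Empty using (⊥-elim)
open import Data.Unit using (⊤; tt)
open import Data.Vec using (lookup) renaming (tabulate to tabulateᵛ)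
open import Data.Vec.Properties using (lookup∘tabulate)
open import Function using (_∘_; id)
open import Function.Bundles using (_⇔_; mk⇔; Equivalence)
open import Relation.Nullary using (Dec; yes; no; ¬_; does; contradiction)
open import Relation.Nullary.Decidable using (from-yes; dec-true; _→-dec_; _×-dec_)
open import Relation.Binary.PropositionalEquality
  using (_≡_; _≢_; _≗_; refl; sym; trans; cong; cong₂; subst; subst₂; module ≡-Reasoning)

-- The cube root comes out of a balance. For `L` rows, `R` places and sets of about `v` rows, the
-- first moment is roughly (c L v / R²)^v with a constant c: each further row costs a factor L/v for
-- its choice and R/v for one more place, and gains (v/R)³ from its three hash values. As v ≤ k, `L`
-- may be of order R²/k, so R of order k b allows k b² rows. The selection variables and the R b
-- slots are then equally many up to a constant, and the L b cells hold all inputs once k b³ is of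
-- order n. With two hash values the same count gives only (c L / R)^v, which forces R to be of
-- order L and saves nothing. All constraints are one-sided: slots, sums and carries may be true
-- without need, since this only makes the upper bound harder to meet. Probabilities never appear.
-- Estimates are cross-multiplied into natural numbers, and the hash function is found by fixing its
-- values one after another without exceeding the average.

private variable
  V W : Set
  l m n r : ℕ

bit : Bool → ℕ
bit b = if b then 1 else 0

interchange : ∀ a b c d → (a + b) + (c + d) ≡ (a + c) + (b + d)
interchange = solve 4 (λ a b c d → (a :+ b) :+ (c :+ d) := (a :+ c) :+ (b :+ d)) refl
  where open +-*-Solver

-- Counting true values

countTrue-cong : {p q : Fin n → Bool} → p ≗ q → countTrue p ≡ countTrue q
countTrue-cong {zero}  eq = refl
countTrue-cong {suc n} eq = cong₂ _+_ (cong bit (eq zero)) (countTrue-cong (eq ∘ suc))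

countTrue-⊆-∪ : (p q s : Fin n → Bool) →
  (∀ x → p x ≡ true → q x ≡ true ⊎ s x ≡ true) → countTrue p ≤ countTrue q + countTrue s
countTrue-⊆-∪ {zero}  p q s p⊆ = z≤n
countTrue-⊆-∪ {suc n} p q s p⊆ = begin
  bit (p zero) + countTrue (p ∘ suc)
    ≤⟨ +-mono-≤ (head (p zero) (q zero) (s zero) (p⊆ zero))
                (countTrue-⊆-∪ (p ∘ suc) (q ∘ suc) (s ∘ suc) (p⊆ ∘ suc)) ⟩
  (bit (q zero) + bit (s zero)) + (countTrue (q ∘ suc) + countTrue (s ∘ suc))
    ≡⟨ interchange (bit (q zero)) (bit (s zero)) _ _ ⟩
  countTrue q + countTrue s ∎
  where
  open ≤-Reasoning
  head : ∀ a b c → (a ≡ true → b ≡ true ⊎ c ≡ true) → bit a ≤ bit b + bit c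
  head false b     c     _  = z≤n
  head true  true  c     _  = s≤s z≤n
  head true  false true  _  = ≤-refl
  head true  false false f with f refl
  ... | inj₁ ()
  ... | inj₂ ()

countTrue-⊆ : (p q : Fin n → Bool) → (∀ x → p x ≡ true → q x ≡ true) → countTrue p ≤ countTrue q
countTrue-⊆ {zero}  p q p⊆q = z≤n
countTrue-⊆ {suc n} p q p⊆q =
  +-mono-≤ (head (p zero) (q zero) (p⊆q zero)) (countTrue-⊆ (p ∘ suc) (q ∘ suc) (p⊆q ∘ suc))
  where
  head : ∀ a b → (a ≡ true → b ≡ true) → bit a ≤ bit b
  head false b _ = z≤n
  head true  b f = ≤-reflexive (cong bit (sym (f refl)))

countTrue-disjoint : (p q s : Fin n → Bool) →
  (∀ x → p x ≡ true → s x ≡ true) → (∀ x → q x ≡ true → s x ≡ true) →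
  (∀ x → p x ≡ true → q x ≢ true) → countTrue p + countTrue q ≤ countTrue s
countTrue-disjoint {zero}  p q s p⊆ q⊆ p∩q = z≤n
countTrue-disjoint {suc n} p q s p⊆ q⊆ p∩q = begin
  countTrue p + countTrue q
    ≡⟨ interchange (bit (p zero)) _ (bit (q zero)) _ ⟩
  (bit (p zero) + bit (q zero)) + (countTrue (p ∘ suc) + countTrue (q ∘ suc))
    ≤⟨ +-mono-≤ (head (p zero) (q zero) (s zero) (p⊆ zero) (q⊆ zero) (p∩q zero))
                (countTrue-disjoint (p ∘ suc) (q ∘ suc) (s ∘ suc) (p⊆ ∘ suc) (q⊆ ∘ suc) (p∩q ∘ suc)) ⟩
  countTrue s ∎
  where
  open ≤-Reasoning
  head : ∀ a b c → (a ≡ true → c ≡ true) → (b ≡ true → c ≡ true) → (a ≡ true → b ≢ true) →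
         bit a + bit b ≤ bit c
  head false false c f g h = z≤n
  head false true  c f g h = ≤-reflexive (cong bit (sym (g refl)))
  head true  false c f g h = ≤-reflexive (cong bit (sym (f refl)))
  head true  true  c f g h = contradiction refl (h refl)

_∖_ : (Fin n → Bool) → Fin n → Fin n → Bool
(p ∖ y) x = if does (x ≟ y) then false else p x

∖-intro : (p : Fin n → Bool) {x y : Fin n} → x ≢ y → p x ≡ true → (p ∖ y) x ≡ true
∖-intro p {x} {y} x≢y px with x ≟ y
... | yes x≡y = contradiction x≡y x≢y
... | no  _   = px

∖-elim : (p : Fin n → Bool) {x y : Fin n} → (p ∖ y) x ≡ true → x ≢ y × p x ≡ true
∖-elim p {x} {y} eq with x ≟ y
... | no x≢y = x≢y , eq

⁅_⁆ : Fin n → Fin n → Bool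
⁅ y ⁆ x = does (x ≟ y)

⁅⁆-elim : {x y : Fin n} → ⁅ y ⁆ x ≡ true → x ≡ y
⁅⁆-elim {x = x} {y} eq with x ≟ y
... | yes x≡y = x≡y

⁅⁆-intro : (x : Fin n) → ⁅ x ⁆ x ≡ true
⁅⁆-intro x with x ≟ x
... | yes _   = refl
... | no  x≢x = contradiction refl x≢x

countTrue-false : (p : Fin n → Bool) → (∀ x → p x ≡ false) → countTrue p ≡ 0
countTrue-false {zero}  p pf = refl
countTrue-false {suc n} p pf = cong₂ _+_ (cong bit (pf zero)) (countTrue-false (p ∘ suc) (pf ∘ suc))

countTrue-⁅⁆ : (y : Fin n) → countTrue ⁅ y ⁆ ≡ 1
countTrue-⁅⁆ {suc n} zero    = cong suc (countTrue-false {n} _ (λ _ → refl))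
countTrue-⁅⁆ {suc n} (suc y) = trans (countTrue-cong {n} (λ x → refl)) (countTrue-⁅⁆ y)

countTrue-∖ : (p : Fin n → Bool) {y : Fin n} → p y ≡ true → suc (countTrue (p ∖ y)) ≤ countTrue p
countTrue-∖ p {y} py = begin
  suc (countTrue (p ∖ y))          ≡⟨ cong (_+ countTrue (p ∖ y)) (countTrue-⁅⁆ y) ⟨
  countTrue ⁅ y ⁆ + countTrue (p ∖ y)
    ≤⟨ countTrue-disjoint ⁅ y ⁆ (p ∖ y) p
         (λ x e → subst (λ z → p z ≡ true) (sym (⁅⁆-elim e)) py)
         (λ x e → proj₂ (∖-elim p e))
         (λ x e e′ → proj₁ (∖-elim p e′) (⁅⁆-elim e)) ⟩
  countTrue p ∎
  where open ≤-Reasoning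

countTrue-injection : (p : Fin n → Bool) (q : Fin m → Bool) (_~_ : Fin n → Fin m → Set) →
  (∀ x → p x ≡ true → ∃ λ y → q y ≡ true × x ~ y) →
  (∀ {x x′ y} → x ~ y → x′ ~ y → x ≡ x′) →
  countTrue p ≤ countTrue q
countTrue-injection {zero}  p q _~_ total inj = z≤n
countTrue-injection {suc n} p q _~_ total inj with p zero in p0
... | false = countTrue-injection (p ∘ suc) q (λ x → suc x ~_) (total ∘ suc) (λ s t → suc-injective (inj s t))
... | true with total zero p0
... | y , qy , 0~y = ≤-trans (s≤s rest) (countTrue-∖ q qy)
  where
  total′ : ∀ x → p (suc x) ≡ true → ∃ λ z → (q ∖ y) z ≡ true × suc x ~ z
  total′ x px with total (suc x) px
  ... | z , qz , x~z = z , ∖-intro q z≢y qz , x~z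
    where
    z≢y : z ≢ y
    z≢y refl with inj 0~y x~z
    ... | ()
  rest : countTrue (p ∘ suc) ≤ countTrue (q ∖ y)
  rest = countTrue-injection (p ∘ suc) (q ∖ y) (λ x → suc x ~_) total′ (λ s t → suc-injective (inj s t))

countTrue-positive : (p : Fin n → Bool) → 1 ≤ countTrue p → ∃ λ x → p x ≡ true
countTrue-positive {suc n} p 1≤ with p zero in p0
... | true  = zero , p0
... | false with countTrue-positive (p ∘ suc) 1≤
... | x , px = suc x , px

-- CNF encodings over an arbitrary set of variables

sat-neg : (σ : V → Bool) {x : V} {C : Clause V} →
  (σ x ≡ true → SatClause σ C) → SatClause σ (neg x ∷ C)
sat-neg σ {x} f with σ x in eq
... | true  = there (f refl)
... | false = here (cong not eq)

sat-neg⁻ : (σ : V → Bool) {x : V} {C : Clause V} →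
  SatClause σ (neg x ∷ C) → σ x ≡ true → SatClause σ C
sat-neg⁻ σ (there s) _ = s
sat-neg⁻ σ (here e) σx with trans (sym e) (cong not σx)
... | ()

renameLit : (V → W) → Lit V → Lit W
renameLit f (pos v) = pos (f v)
renameLit f (neg v) = neg (f v)

rename : (V → W) → CNF V → CNF W
rename f = map (map (renameLit f))

size-rename : (f : V → W) (φ : CNF V) → size (rename f φ) ≡ size φ
size-rename f = length-map (map (renameLit f))

evalLit-rename : {σ : V → Bool} {σ′ : W → Bool} {f : V → W} → (∀ v → σ′ (f v) ≡ σ v) →
  ∀ ℓ → evalLit σ′ (renameLit f ℓ) ≡ evalLit σ ℓ
evalLit-rename eq (pos v) = eq v
evalLit-rename eq (neg v) = cong not (eq v)

sat-rename⁺ : {σ : V → Bool} {σ′ : W → Bool} {f : V → W} → (∀ v → σ′ (f v) ≡ σ v) →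
  ∀ {φ} → SatCNF σ φ → SatCNF σ′ (rename f φ)
sat-rename⁺ eq s =
  All.map⁺ (All.map (λ c → Any.map⁺ (Any.map (λ {ℓ} e → trans (evalLit-rename eq ℓ) e) c)) s)

sat-rename⁻ : {σ : V → Bool} {σ′ : W → Bool} {f : V → W} → (∀ v → σ′ (f v) ≡ σ v) →
  ∀ {φ} → SatCNF σ′ (rename f φ) → SatCNF σ φ
sat-rename⁻ eq s =
  All.map (λ c → Any.map (λ {ℓ} e → trans (sym (evalLit-rename eq ℓ)) e) (Any.map⁻ c)) (All.map⁻ s)

-- The numbers `a` and `c` are budgets rather than exact sizes, so that they add up under
-- composition. The type `V` is arbitrary because the auxiliary variables of one stage are the
-- inputs of the next.
record Encoding {V : Set} (a c : ℕ) (P : (V → Bool) → Set) : Set where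
  field
    aux      : ℕ
    formula  : CNF (V ⊎ Fin aux)
    aux≤     : aux ≤ a
    size≤    : size formula ≤ c
    sound    : ∀ τ ρ → SatCNF [ τ , ρ ] formula → P τ
    complete : ∀ τ → P τ → ∃ λ ρ → SatCNF [ τ , ρ ] formula

open Encoding

module _ {P Q : (V → Bool) → Set} where

  weaken : ∀ {a a′ c c′} → a ≤ a′ → c ≤ c′ → (∀ τ → P τ → Q τ) → (∀ τ → Q τ → P τ) →
    Encoding a c P → Encoding a′ c′ Q
  weaken a≤ c≤ to from E = record
    { aux = aux E ; formula = formula E
    ; aux≤ = ≤-trans (aux≤ E) a≤ ; size≤ = ≤-trans (size≤ E) c≤
    ; sound = λ τ ρ → to τ ∘ sound E τ ρ ; complete = λ τ → complete E τ ∘ from τ }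

  conjunction : ∀ {a a′ c c′} → Encoding a c P → Encoding a′ c′ Q →
    Encoding (a + a′) (c + c′) (λ τ → P τ × Q τ)
  conjunction {c = c} {c′} E F = record
    { aux = aux E + aux F ; formula = φ ++ ψ
    ; aux≤ = +-mono-≤ (aux≤ E) (aux≤ F)
    ; size≤ = size≤′
    ; sound = λ τ ρ s →
        sound E τ (ρ ∘ (_↑ˡ aux F)) (sat-rename⁻ [ (λ _ → refl) , (λ _ → refl) ] (All.++⁻ˡ φ s)) ,
        sound F τ (ρ ∘ (aux E ↑ʳ_)) (sat-rename⁻ [ (λ _ → refl) , (λ _ → refl) ] (All.++⁻ʳ φ s))
    ; complete = complete′ }
    where
    φ ψ : CNF (V ⊎ Fin (aux E + aux F))
    φ = rename (map₂ (_↑ˡ aux F)) (formula E)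
    ψ = rename (map₂ (aux E ↑ʳ_)) (formula F)
    size≤′ : size (φ ++ ψ) ≤ c + c′
    size≤′ = begin
      size (φ ++ ψ)                     ≡⟨ length-++ φ ⟩
      size φ + size ψ                   ≡⟨ cong₂ _+_ (size-rename _ (formula E)) (size-rename _ (formula F)) ⟩
      size (formula E) + size (formula F) ≤⟨ +-mono-≤ (size≤ E) (size≤ F) ⟩
      c + c′ ∎
      where open ≤-Reasoning
    complete′ : ∀ τ → P τ × Q τ → ∃ λ ρ → SatCNF [ τ , ρ ] (φ ++ ψ)
    complete′ τ (p , q) with complete E τ p | complete F τ q
    ... | ρ , s | ρ′ , s′ = [ ρ , ρ′ ] ∘ splitAt (aux E) , All.++⁺
      (sat-rename⁺ [ (λ _ → refl) , (λ y → cong [ ρ , ρ′ ] (splitAt-↑ˡ (aux E) y (aux F))) ] s)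
      (sat-rename⁺ [ (λ _ → refl) , (λ y → cong [ ρ , ρ′ ] (splitAt-↑ʳ (aux E) (aux F) y)) ] s′)

clauses : (φ : CNF V) → Encoding 0 (size φ) (λ τ → SatCNF τ φ)
clauses φ = record
  { aux = 0 ; formula = rename inj₁ φ ; aux≤ = z≤n ; size≤ = ≤-reflexive (size-rename inj₁ φ)
  ; sound = λ τ ρ → sat-rename⁻ (λ _ → refl)
  ; complete = λ τ s → (λ ()) , sat-rename⁺ (λ _ → refl) s }

trivial : {P : (V → Bool) → Set} → (∀ τ → P τ) → Encoding 0 0 P
trivial p = weaken z≤n z≤n (λ τ _ → p τ) (λ _ _ → []) (clauses [])

-- Intermediate variables enter in this way: a constraint is encoded with them as inputs, and
-- quantifying them existentially costs `k` auxiliary variables and no clause.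
project : ∀ k {a c} {Q : (V ⊎ Fin k → Bool) → Set} → Encoding a c Q →
  Encoding (k + a) c (λ τ → ∃ λ ρ → Q [ τ , ρ ])
project {V} k {c = c} {Q} E = record
  { aux = k + aux E ; formula = rename f (formula E)
  ; aux≤ = +-monoʳ-≤ k (aux≤ E)
  ; size≤ = ≤-trans (≤-reflexive (size-rename f (formula E))) (size≤ E)
  ; sound = λ τ ρ s → ρ ∘ (_↑ˡ aux E) ,
      sound E [ τ , ρ ∘ (_↑ˡ aux E) ] (ρ ∘ (k ↑ʳ_))
        (sat-rename⁻ [ [ (λ _ → refl) , (λ _ → refl) ] , (λ _ → refl) ] s)
  ; complete = complete′ }
  where
  f : (V ⊎ Fin k) ⊎ Fin (aux E) → V ⊎ Fin (k + aux E)
  f = [ map₂ (_↑ˡ aux E) , inj₂ ∘ (k ↑ʳ_) ]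
  complete′ : ∀ τ → (∃ λ ρ → Q [ τ , ρ ]) → ∃ λ ρ → SatCNF [ τ , ρ ] (rename f (formula E))
  complete′ τ (ρ , q) with complete E [ τ , ρ ] q
  ... | ρ′ , s = [ ρ , ρ′ ] ∘ splitAt k , sat-rename⁺
    [ [ (λ _ → refl) , (λ y → cong [ ρ , ρ′ ] (splitAt-↑ˡ k y (aux E))) ]
    , (λ y → cong [ ρ , ρ′ ] (splitAt-↑ʳ k (aux E) y)) ] s

-- Restricted formulas and total assignments

SatRestricted : (Fin m → Bool) → Restricted m → Set
SatRestricted ρ satisfied     = ⊤
SatRestricted ρ (remaining D) = SatClause ρ D

sat-restrictClause⁻ : (τ : Fin n → Bool) (ρ : Fin m → Bool) → ∀ C →
  SatRestricted ρ (restrictClause τ C) → SatClause [ τ , ρ ] C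
sat-restrictClause⁻ τ ρ (pos (inj₁ x) ∷ C) s with τ x in eq
... | true  = here eq
... | false = there (sat-restrictClause⁻ τ ρ C s)
sat-restrictClause⁻ τ ρ (neg (inj₁ x) ∷ C) s with τ x in eq
... | true  = there (sat-restrictClause⁻ τ ρ C s)
... | false = here (cong not eq)
sat-restrictClause⁻ τ ρ (pos (inj₂ y) ∷ C) s with restrictClause τ C | sat-restrictClause⁻ τ ρ C | s
... | satisfied   | f | _       = there (f tt)
... | remaining D | f | here e  = here e
... | remaining D | f | there t = there (f t)
sat-restrictClause⁻ τ ρ (neg (inj₂ y) ∷ C) s with restrictClause τ C | sat-restrictClause⁻ τ ρ C | s
... | satisfied   | f | _       = there (f tt)
... | remaining D | f | here e  = here e
... | remaining D | f | there t = there (f t)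

sat-restrictClause⁺ : (τ : Fin n → Bool) (ρ : Fin m → Bool) → ∀ C →
  SatClause [ τ , ρ ] C → SatRestricted ρ (restrictClause τ C)
sat-restrictClause⁺ τ ρ (pos (inj₁ x) ∷ C) s with τ x in eq | s
... | true  | _       = tt
... | false | here e  = contradiction (trans (sym eq) e) λ ()
... | false | there t = sat-restrictClause⁺ τ ρ C t
sat-restrictClause⁺ τ ρ (neg (inj₁ x) ∷ C) s with τ x in eq | s
... | false | _       = tt
... | true  | here e  = contradiction (trans (sym (cong not eq)) e) λ ()
... | true  | there t = sat-restrictClause⁺ τ ρ C t
sat-restrictClause⁺ τ ρ (pos (inj₂ y) ∷ C) s with restrictClause τ C | sat-restrictClause⁺ τ ρ C | s
... | satisfied   | f | _       = tt
... | remaining D | f | here e  = here e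
... | remaining D | f | there t = there (f t)
sat-restrictClause⁺ τ ρ (neg (inj₂ y) ∷ C) s with restrictClause τ C | sat-restrictClause⁺ τ ρ C | s
... | satisfied   | f | _       = tt
... | remaining D | f | here e  = here e
... | remaining D | f | there t = there (f t)

sat-restrict⁻ : (τ : Fin n → Bool) (ρ : Fin m → Bool) → ∀ φ →
  SatCNF ρ (restrict φ τ) → SatCNF [ τ , ρ ] φ
sat-restrict⁻ τ ρ []      s = []
sat-restrict⁻ τ ρ (C ∷ φ) s with restrictClause τ C | sat-restrictClause⁻ τ ρ C | s
... | satisfied   | f | s′     = f tt ∷ sat-restrict⁻ τ ρ φ s′
... | remaining D | f | c ∷ s′ = f c ∷ sat-restrict⁻ τ ρ φ s′

sat-restrict⁺ : (τ : Fin n → Bool) (ρ : Fin m → Bool) → ∀ φ →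
  SatCNF [ τ , ρ ] φ → SatCNF ρ (restrict φ τ)
sat-restrict⁺ τ ρ []      s        = []
sat-restrict⁺ τ ρ (C ∷ φ) (c ∷ s) with restrictClause τ C | sat-restrictClause⁺ τ ρ C c
... | satisfied   | _  = sat-restrict⁺ τ ρ φ s
... | remaining D | c′ = c′ ∷ sat-restrict⁺ τ ρ φ s

encodes : ∀ {a c} {P : (Fin n → Bool) → Set} (E : Encoding a c P) → Encodes (formula E) P
encodes E τ = mk⇔
  (λ p → let ρ , s = complete E τ p in ρ , sat-restrict⁺ τ ρ (formula E) s)
  (λ (ρ , s) → sound E τ ρ (sat-restrict⁻ τ ρ (formula E) s))

-- Counting with full adders

total : (V → Bool) → List V → ℕ
total τ []       = 0
total τ (v ∷ vs) = bit (τ v) + total τ vs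

total-map : (σ : W → Bool) (f : V → W) (vs : List V) → total σ (map f vs) ≡ total (σ ∘ f) vs
total-map σ f []       = refl
total-map σ f (v ∷ vs) = cong (bit (σ (f v)) +_) (total-map σ f vs)

-- Variables 0F, 1F, 2F are the inputs, 3F the sum bit and 4F the carry; only "inputs ≤ outputs" is enforced.
fullAdder : CNF (Fin 5)
fullAdder =
  (neg 0F ∷ neg 1F ∷ pos 4F ∷ []) ∷
  (neg 0F ∷ neg 2F ∷ pos 4F ∷ []) ∷
  (neg 1F ∷ neg 2F ∷ pos 4F ∷ []) ∷
  (neg 0F ∷ pos 3F ∷ pos 4F ∷ []) ∷
  (neg 1F ∷ pos 3F ∷ pos 4F ∷ []) ∷
  (neg 2F ∷ pos 3F ∷ pos 4F ∷ []) ∷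
  (neg 0F ∷ neg 1F ∷ neg 2F ∷ pos 3F ∷ []) ∷ []

satCNF? : (σ : V → Bool) (φ : CNF V) → Dec (SatCNF σ φ)
satCNF? σ = All.all? (Any.any? (λ ℓ → evalLit σ ℓ Bool.≟ true))

∀Bool? : {P : Bool → Set} → (∀ b → Dec (P b)) → Dec (∀ b → P b)
∀Bool? P? with P? true | P? false
... | yes t | yes f = yes λ { true → t ; false → f }
... | no ¬t | _     = no λ p → ¬t (p true)
... | _     | no ¬f = no λ p → ¬f (p false)

five : {A : Set} → A → A → A → A → A → Fin 5 → A
five x y z s c 0F = x
five x y z s c 1F = y
five x y z s c 2F = z
five x y z s c 3F = s
five x y z s c 4F = c

fullAdder-sound : ∀ x y z s c → SatCNF (five x y z s c) fullAdder →
  bit x + (bit y + bit z) ≤ bit s + 2 * bit c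
fullAdder-sound = from-yes (∀Bool? λ x → ∀Bool? λ y → ∀Bool? λ z → ∀Bool? λ s → ∀Bool? λ c →
  satCNF? (five x y z s c) fullAdder →-dec bit x + (bit y + bit z) ≤? bit s + 2 * bit c)

parity majority : Bool → Bool → Bool → Bool
parity   x y z = x xor (y xor z)
majority x y z = (x ∧ y) ∨ (z ∧ (x ∨ y))

fullAdder-complete : ∀ x y z → SatCNF (five x y z (parity x y z) (majority x y z)) fullAdder
fullAdder-complete = from-yes (∀Bool? λ x → ∀Bool? λ y → ∀Bool? λ z →
  satCNF? (five x y z (parity x y z) (majority x y z)) fullAdder)

parity+majority : ∀ x y z → bit (parity x y z) + 2 * bit (majority x y z) ≤ bit x + (bit y + bit z)
parity+majority = from-yes (∀Bool? λ x → ∀Bool? λ y → ∀Bool? λ z →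
  bit (parity x y z) + 2 * bit (majority x y z) ≤? bit x + (bit y + bit z))

even⊎odd : ∀ k → (∃ λ j → k ≡ 2 * j) ⊎ (∃ λ j → k ≡ suc (2 * j))
even⊎odd zero    = inj₁ (0 , refl)
even⊎odd (suc k) with even⊎odd k
... | inj₁ (j , eq) = inj₂ (j , cong suc eq)
... | inj₂ (j , eq) = inj₁ (suc j , trans (cong suc eq) (sym (*-suc 2 j)))

module _ {c j : ℕ} where

  even-halve : 2 * c ≤ 2 * j ⇔ c ≤ j
  even-halve = mk⇔ (*-cancelˡ-≤ 2) (*-monoʳ-≤ 2)

  even-halve-suc : suc (2 * c) ≤ 2 * j ⇔ suc c ≤ j
  even-halve-suc = mk⇔ (*-cancelˡ-< 2 c j) (*-monoʳ-< 2)

  odd-halve : 2 * c ≤ suc (2 * j) ⇔ c ≤ j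
  odd-halve = mk⇔ to (m≤n⇒m≤1+n ∘ *-monoʳ-≤ 2)
    where
    to : 2 * c ≤ suc (2 * j) → c ≤ j
    to h = ≤-pred (*-cancelˡ-< 2 c (suc j) (≤-trans (s≤s h) (≤-reflexive (sym (*-suc 2 j)))))

  odd-halve-suc : suc (2 * c) ≤ suc (2 * j) ⇔ c ≤ j
  odd-halve-suc = mk⇔ (Equivalence.to even-halve ∘ ≤-pred) (s≤s ∘ Equivalence.from even-halve)

-- On division by 2 a lone bit of weight 1 rounds up to a full unit if the bound is even, and is
-- absorbed by the odd unit of the bound otherwise.
halve-even₁ : ∀ x {c j} → (bit x + 0) + 2 * c ≤ 2 * j ⇔ bit x + c ≤ j
halve-even₁ true  = even-halve-suc
halve-even₁ false = even-halve

halve-odd₁ : ∀ x {c j} → (bit x + 0) + 2 * c ≤ suc (2 * j) ⇔ c ≤ j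
halve-odd₁ true  = odd-halve-suc
halve-odd₁ false = odd-halve

-- Against an even bound, one bit of weight 1 costs as much as two, hence the disjunction. An odd
-- bound has one unit to spare, so that only both bits together cost anything, hence the conjunction
-- in `halve-odd₂`.
halve-even₂ : ∀ x y {c j} → (bit x + (bit y + 0)) + 2 * c ≤ 2 * j ⇔ bit (x ∨ y) + c ≤ j
halve-even₂ true  true {c} {j} =
  subst (λ d → d ≤ 2 * j ⇔ suc c ≤ j) (*-suc 2 c) even-halve
halve-even₂ true  false = even-halve-suc
halve-even₂ false y     = halve-even₁ y

halve-odd₂ : ∀ x y {c j} → (bit x + (bit y + 0)) + 2 * c ≤ suc (2 * j) ⇔ bit (x ∧ y) + c ≤ j
halve-odd₂ true  true {c} {j} =
  subst (λ d → d ≤ suc (2 * j) ⇔ suc c ≤ j) (*-suc 2 c) odd-halve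
halve-odd₂ true  false = odd-halve-suc
halve-odd₂ false y     = halve-odd₁ y

-- Only the implications towards the output `d` are imposed: an output that is true without need
-- cannot help to meet an upper bound.
or-gate and-gate : V → V → V → CNF V
or-gate  x y d = (neg x ∷ pos d ∷ []) ∷ (neg y ∷ pos d ∷ []) ∷ []
and-gate x y d = (neg x ∷ neg y ∷ pos d ∷ []) ∷ []

sat-pos : (σ : V → Bool) {x : V} → SatClause σ (pos x ∷ []) → σ x ≡ true
sat-pos σ (here e) = e

bit-mono : ∀ {a b} → (a ≡ true → b ≡ true) → bit a ≤ bit b
bit-mono {false} f = z≤n
bit-mono {true}  f = ≤-reflexive (cong bit (sym (f refl)))

sat-or-gate⁻ : (σ : V → Bool) {x y d : V} → SatCNF σ (or-gate x y d) → σ x ∨ σ y ≡ true → σ d ≡ true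
sat-or-gate⁻ σ {x} {y} (s ∷ t ∷ []) h with σ x in eq
... | true  = sat-pos σ (sat-neg⁻ σ s eq)
... | false = sat-pos σ (sat-neg⁻ σ t h)

sat-or-gate⁺ : (σ : V → Bool) {x y d : V} → σ d ≡ σ x ∨ σ y → SatCNF σ (or-gate x y d)
sat-or-gate⁺ σ {x} {y} eq =
  sat-neg σ (λ e → here (trans eq (cong (_∨ σ y) e))) ∷
  sat-neg σ (λ e → here (trans eq (trans (cong (σ x ∨_) e) (Bool.∨-zeroʳ (σ x))))) ∷ []

sat-and-gate⁻ : (σ : V → Bool) {x y d : V} → SatCNF σ (and-gate x y d) → σ x ∧ σ y ≡ true → σ d ≡ true
sat-and-gate⁻ σ {x} (s ∷ []) h with σ x in eq
... | true = sat-pos σ (sat-neg⁻ σ (sat-neg⁻ σ s eq) h)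

sat-and-gate⁺ : (σ : V → Bool) {x y d : V} → σ d ≡ σ x ∧ σ y → SatCNF σ (and-gate x y d)
sat-and-gate⁺ σ eq = sat-neg σ (λ e → sat-neg σ (λ e′ → here (trans eq (cong₂ _∧_ e e′)))) ∷ []

conjoin-gate : ∀ {a c j} (g : Bool → Bool → Bool) (x y : V) (vs : List V) (ψ : CNF (V ⊎ Fin 1)) →
  (∀ σ → SatCNF σ ψ → g (σ (inj₁ x)) (σ (inj₁ y)) ≡ true → σ (inj₂ 0F) ≡ true) →
  (∀ σ → σ (inj₂ 0F) ≡ g (σ (inj₁ x)) (σ (inj₁ y)) → SatCNF σ ψ) →
  Encoding a c (λ σ → total σ (inj₂ 0F ∷ map inj₁ vs) + 0 ≤ j) →
  Encoding (1 + a) (size ψ + c) (λ τ → bit (g (τ x) (τ y)) + total τ vs ≤ j)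
conjoin-gate {j = j} g x y vs ψ gate⁻ gate⁺ E = weaken ≤-refl ≤-refl to from (project 1 (conjunction (clauses ψ) E))
  where
  open ≤-Reasoning
  to : ∀ τ → (∃ λ ρ → SatCNF [ τ , ρ ] ψ × total [ τ , ρ ] (inj₂ 0F ∷ map inj₁ vs) + 0 ≤ j) →
       bit (g (τ x) (τ y)) + total τ vs ≤ j
  to τ (ρ , s , h) = begin
    bit (g (τ x) (τ y)) + total τ vs                 ≤⟨ +-monoˡ-≤ (total τ vs) (bit-mono (gate⁻ [ τ , ρ ] s)) ⟩
    bit (ρ 0F) + total τ vs                          ≡⟨ cong (bit (ρ 0F) +_) (total-map [ τ , ρ ] inj₁ vs) ⟨
    bit (ρ 0F) + total [ τ , ρ ] (map inj₁ vs)       ≡⟨ +-identityʳ _ ⟨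
    total [ τ , ρ ] (inj₂ 0F ∷ map inj₁ vs) + 0      ≤⟨ h ⟩
    j ∎
  from : ∀ τ → bit (g (τ x) (τ y)) + total τ vs ≤ j →
       ∃ λ ρ → SatCNF [ τ , ρ ] ψ × total [ τ , ρ ] (inj₂ 0F ∷ map inj₁ vs) + 0 ≤ j
  from τ h = ρ , gate⁺ [ τ , ρ ] refl , (begin
    total [ τ , ρ ] (inj₂ 0F ∷ map inj₁ vs) + 0      ≡⟨ +-identityʳ _ ⟩
    bit (ρ 0F) + total [ τ , ρ ] (map inj₁ vs)       ≡⟨ cong (bit (ρ 0F) +_) (total-map [ τ , ρ ] inj₁ vs) ⟩
    bit (g (τ x) (τ y)) + total τ vs                 ≤⟨ h ⟩
    j ∎)
    where
    ρ : Fin 1 → Bool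
    ρ _ = g (τ x) (τ y)

conjoin-fullAdder : ∀ {a c k} (x y z : V) (us vs : List V) →
  Encoding a c (λ σ → total σ (inj₂ 0F ∷ map inj₁ us) + 2 * total σ (inj₂ 1F ∷ map inj₁ vs) ≤ k) →
  Encoding (2 + a) (7 + c) (λ τ → total τ (x ∷ y ∷ z ∷ us) + 2 * total τ vs ≤ k)
conjoin-fullAdder {V} {k = k} x y z us vs E = weaken ≤-refl ≤-refl to from (project 2 (conjunction (clauses ψ) E))
  where
  open ≤-Reasoning
  vars : Fin 5 → V ⊎ Fin 2
  vars = five (inj₁ x) (inj₁ y) (inj₁ z) (inj₂ 0F) (inj₂ 1F)
  ψ : CNF (V ⊎ Fin 2)
  ψ = rename vars fullAdder
  vars-≗ : ∀ (σ : V ⊎ Fin 2 → Bool) i →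
    σ (vars i) ≡ five (σ (inj₁ x)) (σ (inj₁ y)) (σ (inj₁ z)) (σ (inj₂ 0F)) (σ (inj₂ 1F)) i
  vars-≗ σ 0F = refl
  vars-≗ σ 1F = refl
  vars-≗ σ 2F = refl
  vars-≗ σ 3F = refl
  vars-≗ σ 4F = refl
  inputs : ∀ a b c u v → (a + (b + (c + u))) + 2 * v ≡ (a + (b + c)) + (u + 2 * v)
  inputs = solve 5 (λ a b c u v → (a :+ (b :+ (c :+ u))) :+ con 2 :* v := (a :+ (b :+ c)) :+ (u :+ con 2 :* v)) refl
    where open +-*-Solver
  outputs : ∀ s c u v → (s + u) + 2 * (c + v) ≡ (s + 2 * c) + (u + 2 * v)
  outputs = solve 4 (λ s c u v → (s :+ u) :+ con 2 :* (c :+ v) := (s :+ con 2 :* c) :+ (u :+ con 2 :* v)) refl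
    where open +-*-Solver
  P : (V → Bool) → Set
  P τ = total τ (x ∷ y ∷ z ∷ us) + 2 * total τ vs ≤ k
  Q : (V ⊎ Fin 2 → Bool) → Set
  Q σ = total σ (inj₂ 0F ∷ map inj₁ us) + 2 * total σ (inj₂ 1F ∷ map inj₁ vs) ≤ k
  outputs-≡ : ∀ τ ρ → total [ τ , ρ ] (inj₂ 0F ∷ map inj₁ us) + 2 * total [ τ , ρ ] (inj₂ 1F ∷ map inj₁ vs)
    ≡ (bit (ρ 0F) + 2 * bit (ρ 1F)) + (total τ us + 2 * total τ vs)
  outputs-≡ τ ρ = trans
    (cong₂ (λ u v → (bit (ρ 0F) + u) + 2 * (bit (ρ 1F) + v))
      (total-map [ τ , ρ ] inj₁ us) (total-map [ τ , ρ ] inj₁ vs))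
    (outputs (bit (ρ 0F)) (bit (ρ 1F)) (total τ us) (total τ vs))
  to : ∀ τ → (∃ λ ρ → SatCNF [ τ , ρ ] ψ × Q [ τ , ρ ]) → P τ
  to τ (ρ , s , h) = begin
    total τ (x ∷ y ∷ z ∷ us) + 2 * total τ vs
      ≡⟨ inputs (bit (τ x)) (bit (τ y)) (bit (τ z)) (total τ us) (total τ vs) ⟩
    (bit (τ x) + (bit (τ y) + bit (τ z))) + (total τ us + 2 * total τ vs)
      ≤⟨ +-monoˡ-≤ _ (fullAdder-sound (τ x) (τ y) (τ z) (ρ 0F) (ρ 1F) (sat-rename⁻ {f = vars} (vars-≗ [ τ , ρ ]) s)) ⟩
    (bit (ρ 0F) + 2 * bit (ρ 1F)) + (total τ us + 2 * total τ vs)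
      ≡⟨ outputs-≡ τ ρ ⟨
    total [ τ , ρ ] (inj₂ 0F ∷ map inj₁ us) + 2 * total [ τ , ρ ] (inj₂ 1F ∷ map inj₁ vs)
      ≤⟨ h ⟩
    k ∎
  from : ∀ τ → P τ → ∃ λ ρ → SatCNF [ τ , ρ ] ψ × Q [ τ , ρ ]
  from τ h = ρ , sat-rename⁺ {f = vars} (vars-≗ [ τ , ρ ]) (fullAdder-complete (τ x) (τ y) (τ z)) , (begin
    total [ τ , ρ ] (inj₂ 0F ∷ map inj₁ us) + 2 * total [ τ , ρ ] (inj₂ 1F ∷ map inj₁ vs)
      ≡⟨ outputs-≡ τ ρ ⟩
    (bit (ρ 0F) + 2 * bit (ρ 1F)) + (total τ us + 2 * total τ vs)
      ≤⟨ +-monoˡ-≤ _ (parity+majority (τ x) (τ y) (τ z)) ⟩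
    (bit (τ x) + (bit (τ y) + bit (τ z))) + (total τ us + 2 * total τ vs)
      ≡⟨ inputs (bit (τ x)) (bit (τ y)) (bit (τ z)) (total τ us) (total τ vs) ⟨
    total τ (x ∷ y ∷ z ∷ us) + 2 * total τ vs
      ≤⟨ h ⟩
    k ∎)
    where
    ρ : Fin 2 → Bool
    ρ 0F = parity (τ x) (τ y) (τ z)
    ρ 1F = majority (τ x) (τ y) (τ z)

-- Each full adder lowers the number of bits by one and costs two variables and seven clauses, hence
-- 2 and 7 per bit. The gates used before halving also lower it by one and are cheaper.
Counter : List V → List V → ℕ → Set
Counter us vs k = Encoding (2 * (length us + length vs)) (7 * (length us + length vs))
                           (λ τ → total τ us + 2 * total τ vs ≤ k)

≤-drop-0 : ∀ {a k} → a + 0 ≤ k ⇔ a ≤ k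
≤-drop-0 {a} {k} = mk⇔ (subst (_≤ k) (+-identityʳ a)) (subst (_≤ k) (sym (+-identityʳ a)))

via : {P Q R : Set} → P ⇔ Q → R ⇔ Q → P → R
via f g = Equivalence.from g ∘ Equivalence.to f

spare : ∀ {a b f} d → a ≡ suc (b + d) → a ≤ suc f → b ≤ f
spare {b = b} d refl (s≤s h) = m+n≤o⇒m≤o b h

bit≤0 : ∀ {b} → b ≡ false → bit b + 0 + 0 ≤ 0
bit≤0 refl = z≤n

bit≤suc : ∀ b {k} → bit b + 0 + 0 ≤ suc k
bit≤suc true  = s≤s z≤n
bit≤suc false = z≤n

-- A full adder replaces three bits of weight 1 by one of weight 1 and one of weight 2, so the number of
-- bits drops at each adder. Once at most two bits of weight 1 are left, the bound is halved.
counter : ∀ fuel k (us vs : List V) → 2 * length us + 3 * length vs ≤ fuel → Counter us vs k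
-- The measure gives 2 to a bit of weight 1 and 3 to a bit of weight 2. A full adder lowers it by 3
-- * 2 - (2 + 3) = 1, and halving lowers it because every 3 becomes a 2.
counter fuel k [] [] _ = trivial (λ _ → z≤n)
counter fuel zero (x ∷ []) [] _ = weaken z≤n (s≤s z≤n) to from (clauses ((neg x ∷ []) ∷ []))
  where
  to : ∀ τ → SatCNF τ ((neg x ∷ []) ∷ []) → bit (τ x) + 0 + 0 ≤ 0
  to τ (here e ∷ []) = bit≤0 (Bool.not-injective e)
  from : ∀ τ → bit (τ x) + 0 + 0 ≤ 0 → SatCNF τ ((neg x ∷ []) ∷ [])
  from τ h with τ x in eq
  ... | false = here (cong not eq) ∷ []
counter fuel (suc k) (x ∷ []) [] _ = weaken z≤n z≤n (λ _ → id) (λ _ → id) (trivial (λ τ → bit≤suc (τ x)))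
counter (suc fuel) k [] (v ∷ vs) h = by-parity (even⊎odd k)
  where
  len = length (v ∷ vs)
  bound : len + 0 ≤ len
  bound = ≤-reflexive (+-identityʳ len)
  fuel≥ : 2 * len + 0 ≤ fuel
  fuel≥ = spare (length vs) (identity (length vs)) h
    where
    open +-*-Solver
    identity : ∀ m → 3 * suc m ≡ suc (2 * suc m + 0 + m)
    identity = solve 1 (λ m → con 3 :* (con 1 :+ m) := con 1 :+ (con 2 :* (con 1 :+ m) :+ con 0 :+ m)) refl
  by-parity : (∃ λ j → k ≡ 2 * j) ⊎ (∃ λ j → k ≡ suc (2 * j)) → Counter [] (v ∷ vs) k
  by-parity (inj₁ (j , refl)) = weaken (*-monoʳ-≤ 2 bound) (*-monoʳ-≤ 7 bound)
    (λ _ → via ≤-drop-0 even-halve) (λ _ → via even-halve ≤-drop-0) (counter fuel j (v ∷ vs) [] fuel≥)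
  by-parity (inj₂ (j , refl)) = weaken (*-monoʳ-≤ 2 bound) (*-monoʳ-≤ 7 bound)
    (λ _ → via ≤-drop-0 odd-halve) (λ _ → via odd-halve ≤-drop-0) (counter fuel j (v ∷ vs) [] fuel≥)
counter (suc fuel) k (x ∷ []) (v ∷ vs) h = by-parity (even⊎odd k)
  where
  len = length (v ∷ vs)
  bound : len + 0 ≤ len
  bound = ≤-reflexive (+-identityʳ len)
  fuel≥ : 2 * suc len + 0 ≤ fuel
  fuel≥ = spare (length vs) (identity (length vs)) h
    where
    open +-*-Solver
    identity : ∀ m → 2 * 1 + 3 * suc m ≡ suc (2 * suc (suc m) + 0 + m)
    identity = solve 1 (λ m → con 2 :+ con 3 :* (con 1 :+ m) := con 1 :+ (con 2 :* (con 2 :+ m) :+ con 0 :+ m)) refl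
  by-parity : (∃ λ j → k ≡ 2 * j) ⊎ (∃ λ j → k ≡ suc (2 * j)) → Counter (x ∷ []) (v ∷ vs) k
  by-parity (inj₁ (j , refl)) = weaken (*-monoʳ-≤ 2 (s≤s bound)) (*-monoʳ-≤ 7 (s≤s bound))
    (λ τ → via ≤-drop-0 (halve-even₁ (τ x))) (λ τ → via (halve-even₁ (τ x)) ≤-drop-0)
    (counter fuel j (x ∷ v ∷ vs) [] fuel≥)
  by-parity (inj₂ (j , refl)) = weaken (*-monoʳ-≤ 2 (m≤n⇒m≤1+n bound)) (*-monoʳ-≤ 7 (m≤n⇒m≤1+n bound))
    (λ τ → via ≤-drop-0 (halve-odd₁ (τ x))) (λ τ → via (halve-odd₁ (τ x)) ≤-drop-0)
    (counter fuel j (v ∷ vs) [] (≤-trans (+-monoˡ-≤ 0 (*-monoʳ-≤ 2 (n≤1+n len))) fuel≥))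
counter {V} (suc fuel) k (x ∷ y ∷ []) vs h = by-parity (even⊎odd k)
  where
  vs′ : List (V ⊎ Fin 1)
  vs′ = map inj₁ vs
  len : length vs′ ≡ length vs
  len = length-map inj₁ vs
  bound : ∀ c d → d ≤ c → d + c * (suc (length vs′) + 0) ≤ c * (2 + length vs)
  bound c d d≤c = begin
    d + c * (suc (length vs′) + 0) ≡⟨ cong (λ m → d + c * m) (trans (+-identityʳ _) (cong suc len)) ⟩
    d + c * suc (length vs)        ≤⟨ +-monoˡ-≤ _ d≤c ⟩
    c + c * suc (length vs)        ≡⟨ *-suc c (suc (length vs)) ⟨
    c * (2 + length vs)            ∎
    where open ≤-Reasoning
  fuel≥ : 2 * suc (length vs′) + 0 ≤ fuel
  fuel≥ = subst (λ m → 2 * suc m + 0 ≤ fuel) (sym len) (spare (suc (length vs)) (identity (length vs)) h)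
    where
    open +-*-Solver
    identity : ∀ m → 2 * 2 + 3 * m ≡ suc (2 * suc m + 0 + suc m)
    identity = solve 1 (λ m → con 4 :+ con 3 :* m := con 1 :+ (con 2 :* (con 1 :+ m) :+ con 0 :+ (con 1 :+ m))) refl
  by-parity : (∃ λ j → k ≡ 2 * j) ⊎ (∃ λ j → k ≡ suc (2 * j)) → Counter (x ∷ y ∷ []) vs k
  by-parity (inj₁ (j , refl)) = weaken (bound 2 1 (s≤s z≤n)) (bound 7 2 (s≤s (s≤s z≤n)))
    (λ τ → Equivalence.from (halve-even₂ (τ x) (τ y))) (λ τ → Equivalence.to (halve-even₂ (τ x) (τ y)))
    (conjoin-gate _∨_ x y vs (or-gate (inj₁ x) (inj₁ y) (inj₂ 0F))
      (λ σ → sat-or-gate⁻ σ) (λ σ → sat-or-gate⁺ σ) (counter fuel j (inj₂ 0F ∷ vs′) [] fuel≥))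
  by-parity (inj₂ (j , refl)) = weaken (bound 2 1 (s≤s z≤n)) (bound 7 1 (s≤s z≤n))
    (λ τ → Equivalence.from (halve-odd₂ (τ x) (τ y))) (λ τ → Equivalence.to (halve-odd₂ (τ x) (τ y)))
    (conjoin-gate _∧_ x y vs (and-gate (inj₁ x) (inj₁ y) (inj₂ 0F))
      (λ σ → sat-and-gate⁻ σ) (λ σ → sat-and-gate⁺ σ) (counter fuel j (inj₂ 0F ∷ vs′) [] fuel≥))
counter {V} (suc fuel) k (x ∷ y ∷ z ∷ us) vs h = weaken (bound 2) (bound 7) (λ _ → id) (λ _ → id)
  (conjoin-fullAdder x y z us vs (counter fuel k (inj₂ 0F ∷ us′) (inj₂ 1F ∷ vs′) fuel≥))
  where
  us′ vs′ : List (V ⊎ Fin 2)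
  us′ = map inj₁ us
  vs′ = map inj₁ vs
  bound : ∀ c → c + c * (suc (length us′) + suc (length vs′)) ≤ c * (3 + length us + length vs)
  bound c = ≤-reflexive (trans (cong₂ (λ p q → c + c * (suc p + suc q)) (length-map inj₁ us) (length-map inj₁ vs))
    (identity c (length us) (length vs)))
    where
    open +-*-Solver
    identity : ∀ c p q → c + c * (suc p + suc q) ≡ c * (3 + p + q)
    identity = solve 3 (λ c p q → c :+ c :* ((con 1 :+ p) :+ (con 1 :+ q)) := c :* (con 3 :+ p :+ q)) refl
  fuel≥ : 2 * suc (length us′) + 3 * suc (length vs′) ≤ fuel
  fuel≥ = subst (_≤ fuel)
    (sym (cong₂ (λ p q → 2 * suc p + 3 * suc q) (length-map inj₁ us) (length-map inj₁ vs)))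
    (spare 0 (identity (length us) (length vs)) h)
    where
    open +-*-Solver
    identity : ∀ p q → 2 * (3 + p) + 3 * q ≡ suc (2 * suc p + 3 * suc q + 0)
    identity = solve 2 (λ p q → con 2 :* (con 3 :+ p) :+ con 3 :* q :=
      con 1 :+ (con 2 :* (con 1 :+ p) :+ con 3 :* (con 1 :+ q) :+ con 0)) refl

-- Sequential at-most-one constraints, one chain for each value of key: cur i tells whether a variable with
-- key i has been seen to be true.
injective-from : ∀ (key : Fin n → Fin r) (sel : Fin n → V) (cur : Fin r → V) →
  Encoding n (n * 3) (λ τ →
    (∀ e → τ (sel e) ≡ true → τ (cur (key e)) ≡ false) ×
    (∀ e e′ → τ (sel e) ≡ true → τ (sel e′) ≡ true → key e ≡ key e′ → e ≡ e′))
injective-from {zero}  key sel cur = trivial (λ τ → (λ ()) , (λ ()))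
injective-from {suc n} {r} {V} key sel cur = weaken ≤-refl ≤-refl to from
  (project 1 (conjunction (clauses ψ) (injective-from (key ∘ suc) (inj₁ ∘ sel ∘ suc) cur′)))
  where
  i = key zero
  t : V ⊎ Fin 1
  t = inj₂ 0F
  ψ : CNF (V ⊎ Fin 1)
  ψ = (neg (inj₁ (cur i)) ∷ pos t ∷ []) ∷
      (neg (inj₁ (sel zero)) ∷ pos t ∷ []) ∷
      (neg (inj₁ (cur i)) ∷ neg (inj₁ (sel zero)) ∷ []) ∷ []
  cur′ : Fin r → V ⊎ Fin 1
  -- Only the chain of key `i` advances to the new variable. The other chains keep their state, so
  -- each input costs one variable whatever the number of keys.
  cur′ j = if does (j ≟ i) then t else inj₁ (cur j)
  cur′-≡ : ∀ {j} → j ≡ i → cur′ j ≡ t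
  cur′-≡ {j} j≡i with j ≟ i
  ... | yes _   = refl
  ... | no  j≢i = contradiction j≡i j≢i
  P : (V → Bool) → Set
  P τ = (∀ e → τ (sel e) ≡ true → τ (cur (key e)) ≡ false) ×
        (∀ e e′ → τ (sel e) ≡ true → τ (sel e′) ≡ true → key e ≡ key e′ → e ≡ e′)
  Q : (V ⊎ Fin 1 → Bool) → Set
  Q σ = (∀ e → σ (inj₁ (sel (suc e))) ≡ true → σ (cur′ (key (suc e))) ≡ false) ×
        (∀ e e′ → σ (inj₁ (sel (suc e))) ≡ true → σ (inj₁ (sel (suc e′))) ≡ true →
           key (suc e) ≡ key (suc e′) → e ≡ e′)
  to : ∀ τ → (∃ λ ρ → SatCNF [ τ , ρ ] ψ × Q [ τ , ρ ]) → P τ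
  to τ (ρ , (cur→t ∷ sel→t ∷ cur→¬sel ∷ []) , fresh , inj) = fresh′ , inj′
    where
    σ = [ τ , ρ ]
    distinct : ∀ e → τ (sel zero) ≡ true → τ (sel (suc e)) ≡ true → i ≢ key (suc e)
    distinct e s s′ eq = contradiction
      (trans (sym (sat-pos σ (sat-neg⁻ σ sel→t s))) (trans (cong σ (sym (cur′-≡ (sym eq)))) (fresh e s′))) λ ()
    fresh′ : ∀ e → τ (sel e) ≡ true → τ (cur (key e)) ≡ false
    fresh′ zero s with τ (cur i) in eq
    ... | false = refl
    ... | true with sat-neg⁻ σ (sat-neg⁻ σ cur→¬sel eq) s
    ... | ()
    fresh′ (suc e) s with key (suc e) ≟ i | fresh e s
    ... | no  _  | f = f
    ... | yes eq | f with τ (cur (key (suc e))) in c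
    ... | false = refl
    ... | true  = contradiction
          (trans (sym (sat-pos σ (sat-neg⁻ σ cur→t (trans (cong (τ ∘ cur) (sym eq)) c)))) f) λ ()
    inj′ : ∀ e e′ → τ (sel e) ≡ true → τ (sel e′) ≡ true → key e ≡ key e′ → e ≡ e′
    inj′ zero    zero     s s′ eq = refl
    inj′ zero    (suc e′) s s′ eq = contradiction eq (distinct e′ s s′)
    inj′ (suc e) zero     s s′ eq = contradiction (sym eq) (distinct e s′ s)
    inj′ (suc e) (suc e′) s s′ eq = cong suc (inj e e′ s s′ eq)
  from : ∀ τ → P τ → ∃ λ ρ → SatCNF [ τ , ρ ] ψ × Q [ τ , ρ ]
  from τ (fresh , inj) = ρ , sat , fresh′ , λ e e′ s s′ eq → suc-injective (inj (suc e) (suc e′) s s′ eq)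
    where
    ρ : Fin 1 → Bool
    ρ _ = τ (cur i) ∨ τ (sel zero)
    σ = [ τ , ρ ]
    sat : SatCNF σ ψ
    sat = sat-neg σ (λ e → here (cong (_∨ τ (sel zero)) e))
        ∷ sat-neg σ (λ e → here (trans (cong (τ (cur i) ∨_) e) (Bool.∨-zeroʳ (τ (cur i)))))
        ∷ sat-neg σ (λ e → sat-neg σ (λ e′ → contradiction (trans (sym e) (fresh zero e′)) λ ()))
        ∷ []
    fresh′ : ∀ e → τ (sel (suc e)) ≡ true → σ (cur′ (key (suc e))) ≡ false
    fresh′ e s with key (suc e) ≟ i
    ... | no  _  = fresh (suc e) s
    ... | yes eq = cong₂ _∨_ (trans (cong (τ ∘ cur) (sym eq)) (fresh (suc e) s)) sel-zero
      where
      sel-zero : τ (sel zero) ≡ false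
      sel-zero with τ (sel zero) in s′
      ... | false = refl
      ... | true with inj zero (suc e) s′ s (sym eq)
      ... | ()

-- The initial states of the `r` chains are auxiliary variables that no clause forces: a true one
-- only forbids more selections, and completeness sets them all to false.
injective-on-true : ∀ (key : Fin n → Fin r) (sel : Fin n → V) →
  Encoding (r + n) (n * 3) (λ τ → ∀ e e′ → τ (sel e) ≡ true → τ (sel e′) ≡ true → key e ≡ key e′ → e ≡ e′)
injective-on-true {r = r} key sel = weaken ≤-refl ≤-refl
  (λ τ (ρ , fresh , inj) → inj)
  (λ τ inj → (λ _ → false) , (λ e s → refl) , inj)
  (project r (injective-from key (inj₁ ∘ sel) inj₂))

total-tabulate : (τ : V → Bool) (w : Fin n → V) → total τ (tabulate w) ≡ countTrue (τ ∘ w)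
total-tabulate {n = zero}  τ w = refl
total-tabulate {n = suc n} τ w = cong (bit (τ (w zero)) +_) (total-tabulate τ (w ∘ suc))

atMost : ∀ k (w : Fin n → V) → Encoding (2 * n) (7 * n) (λ τ → countTrue (τ ∘ w) ≤ k)
atMost {n} k w = weaken (*-monoʳ-≤ 2 bound) (*-monoʳ-≤ 7 bound) 
  (λ τ → subst (_≤ k) (count τ)) (λ τ → subst (_≤ k) (sym (count τ)))
  (counter _ k (tabulate w) [] ≤-refl)
  where
  bound : length (tabulate w) + 0 ≤ n
  bound = ≤-reflexive (trans (+-identityʳ _) (length-tabulate w))
  count : ∀ τ → total τ (tabulate w) + 0 ≡ countTrue (τ ∘ w)
  count τ = trans (+-identityʳ _) (total-tabulate τ w)

-- Hall's marriage theorem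

_⊆_ : (p q : Fin n → Bool) → Set
p ⊆ q = ∀ x → p x ≡ true → q x ≡ true

_∩_ _∪_ _─_ : (p q : Fin n → Bool) → Fin n → Bool
(p ∩ q) x = p x ∧ q x
(p ∪ q) x = p x ∨ q x
(p ─ q) x = p x ∧ not (q x)

∧-elim : ∀ {a b} → a ∧ b ≡ true → a ≡ true × b ≡ true
∧-elim {true} {true} _ = refl , refl

∨-elim : ∀ {a b} → a ∨ b ≡ true → a ≡ true ⊎ b ≡ true
∨-elim {true}  _ = inj₁ refl
∨-elim {false} e = inj₂ e

not-true : ∀ {b} → not b ≡ true → b ≢ true
not-true {false} _ ()

module Hall {d : ℕ} (h : Fin l → Fin (suc d) → Fin r) where

  neighbour? : (T : Fin l → Bool) (v : Fin r) → Dec (∃ λ i → T i ≡ true × ∃ λ c → h i c ≡ v)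
  neighbour? T v = any? λ i → T i Bool.≟ true ×-dec any? λ c → h i c ≟ v

  N : (Fin l → Bool) → Fin r → Bool
  N T v = does (neighbour? T v)

  N-elim : ∀ T {v} → N T v ≡ true → ∃ λ i → T i ≡ true × ∃ λ c → h i c ≡ v
  N-elim T {v} e with neighbour? T v
  ... | yes w = w

  N-intro : ∀ T {i} → T i ≡ true → ∀ c → N T (h i c) ≡ true
  N-intro T {i} t c = dec-true (neighbour? T (h i c)) (i , t , c , refl)

  N-mono : ∀ {T U} → T ⊆ U → N T ⊆ N U
  N-mono {T} {U} T⊆U v e with N-elim T e
  ... | i , t , c , refl = N-intro U (T⊆U i t) c

  -- The set `A` of right vertices still available is a parameter because the induction removes
  -- vertices on both sides.
  HallCondition : (Fin l → Bool) → (Fin r → Bool) → Set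
  HallCondition S A = ∀ T → T ⊆ S → countTrue T ≤ countTrue (N T ∩ A)

  -- A partner is recorded as an index into the list of neighbours, the form in which the encoding
  -- selects it. Outside `S` the values of `f` are arbitrary, and `suc d` guarantees that there is
  -- one.
  Matching : (Fin l → Bool) → (Fin r → Bool) → Set
  Matching S A = Σ (Fin l → Fin (suc d)) λ f →
    (∀ i → S i ≡ true → A (h i (f i)) ≡ true) ×
    (∀ i j → S i ≡ true → S j ≡ true → h i (f i) ≡ h j (f j) → i ≡ j)

  glue : ∀ {S T A B} → B ⊆ A → Matching T B → Matching (S ─ T) (A ─ B) → Matching S A
  glue {S} {T} {A} {B} B⊆A (f , f-in , f-inj) (g , g-in , g-inj) = k , k-in , k-inj
    where
    k : Fin l → Fin (suc d)
    k i = if T i then f i else g i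
    data View (i : Fin l) : Set where
      left  : T i ≡ true → k i ≡ f i → View i
      right : (S ─ T) i ≡ true → k i ≡ g i → View i
    view : ∀ i → S i ≡ true → View i
    view i s with T i in eq
    ... | true  = left eq (cong (if_then f i else g i) eq)
    ... | false = right (cong₂ _∧_ s (cong not eq)) (cong (if_then f i else g i) eq)
    k-in : ∀ i → S i ≡ true → A (h i (k i)) ≡ true
    k-in i s with view i s
    ... | left  t eq rewrite eq = B⊆A _ (f-in i t)
    ... | right t eq rewrite eq = proj₁ (∧-elim (g-in i t))
    cross : ∀ {i j} → T i ≡ true → (S ─ T) j ≡ true → h i (f i) ≢ h j (g j)
    cross {i} {j} t u eq = not-true (proj₂ (∧-elim (g-in j u))) (trans (cong B (sym eq)) (f-in i t))
    k-inj : ∀ i j → S i ≡ true → S j ≡ true → h i (k i) ≡ h j (k j) → i ≡ j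
    k-inj i j s s′ with view i s | view j s′
    ... | left  t eq | left  u eq′ rewrite eq | eq′ = f-inj i j t u
    ... | left  t eq | right u eq′ rewrite eq | eq′ = λ e → contradiction e (cross t u)
    ... | right t eq | left  u eq′ rewrite eq | eq′ = λ e → contradiction (sym e) (cross u t)
    ... | right t eq | right u eq′ rewrite eq | eq′ = g-inj i j t u

  -- Under Hall's condition the last inequality is an equality. Being nonempty and of smaller size
  -- than `S` makes both `T` and `S ─ T` smaller than `S`, as the induction requires.
  Tight : (S : Fin l → Bool) (A : Fin r → Bool) → (Fin l → Bool) → Set
  Tight S A T = T ⊆ S × 1 ≤ countTrue T × countTrue T < countTrue S × countTrue (N T ∩ A) ≤ countTrue T

  tight? : ∀ S A T → Dec (Tight S A T)
  tight? S A T = all? (λ x → T x Bool.≟ true →-dec S x Bool.≟ true) ×-dec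
    (1 ≤? countTrue T) ×-dec (countTrue T <? countTrue S) ×-dec (countTrue (N T ∩ A) ≤? countTrue T)

  -- The exhaustive search for a tight set runs over bit vectors. This carries its negative answer
  -- over to arbitrary predicates, which agree with a vector only pointwise.
  tight-cong : ∀ {S A T U} → T ≗ U → Tight S A T → Tight S A U
  tight-cong {S} {A} {T} {U} T≗U (T⊆S , 1≤T , T<S , tight) =
    (λ x u → T⊆S x (trans (T≗U x) u)) , subst (1 ≤_) count 1≤T , subst (_< countTrue S) count T<S ,
    ≤-trans (countTrue-⊆ (N U ∩ A) (N T ∩ A) mono) (≤-trans tight (≤-reflexive count))
    where
    count : countTrue T ≡ countTrue U
    count = countTrue-cong T≗U
    mono : (N U ∩ A) ⊆ (N T ∩ A)
    mono v e = cong₂ _∧_ (N-mono (λ x u → trans (T≗U x) u) v (proj₁ (∧-elim e))) (proj₂ (∧-elim {N U v} e))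

  -- A tight `T` has no neighbours to spare, so if some `U` had too few neighbours outside those of
  -- `T`, then `U ∪ T` would violate Hall's condition.
  hall-tight : ∀ {S A T} → HallCondition S A → Tight S A T → HallCondition (S ─ T) (A ─ (N T ∩ A))
  hall-tight {S} {A} {T} hall (T⊆S , _ , _ , tight) U U⊆S─T = +-cancelʳ-≤ (countTrue T) _ _ (begin
    countTrue U + countTrue T
      ≤⟨ countTrue-disjoint U T (U ∪ T) (λ x u → cong (_∨ T x) u)
           (λ x t → trans (cong (U x ∨_) t) (Bool.∨-zeroʳ (U x)))
           (λ x u → not-true (proj₂ (∧-elim {S x} (U⊆S─T x u)))) ⟩
    countTrue (U ∪ T)
      ≤⟨ hall (U ∪ T) (λ x e → [ (λ u → proj₁ (∧-elim (U⊆S─T x u))) , T⊆S x ] (∨-elim e)) ⟩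
    countTrue (N (U ∪ T) ∩ A)
      ≤⟨ countTrue-⊆-∪ (N (U ∪ T) ∩ A) (N U ∩ (A ─ (N T ∩ A))) (N T ∩ A) split ⟩
    countTrue (N U ∩ (A ─ (N T ∩ A))) + countTrue (N T ∩ A)
      ≤⟨ +-monoʳ-≤ _ tight ⟩
    countTrue (N U ∩ (A ─ (N T ∩ A))) + countTrue T ∎)
    where
    open ≤-Reasoning
    split : ∀ v → (N (U ∪ T) ∩ A) v ≡ true →
      (N U ∩ (A ─ (N T ∩ A))) v ≡ true ⊎ (N T ∩ A) v ≡ true
    split v e with (N T ∩ A) v in eq
    ... | true  = inj₂ refl
    ... | false with N-elim (U ∪ T) (proj₁ (∧-elim e)) | proj₂ (∧-elim {N (U ∪ T) v} e)
    ... | i , ut , c , refl | a with ∨-elim {U i} ut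
    ... | inj₁ u = inj₁ (cong₂ _∧_ (N-intro U u c) (cong₂ _∧_ a refl))
    ... | inj₂ t = contradiction (trans (sym eq) (cong₂ _∧_ (N-intro T t c) a)) λ ()

  -- Without tight sets, every nonempty `U` of smaller size than `S` has at least one neighbour more
  -- than elements and survives the loss of `v`. The sets to be checked omit `i`, so they are indeed
  -- smaller.
  hall-loose : ∀ {S A i v} → HallCondition S A → (∀ T → ¬ Tight S A T) → S i ≡ true →
    HallCondition (S ─ ⁅ i ⁆) (A ─ ⁅ v ⁆)
  hall-loose {S} {A} {i} {v} hall loose s U U⊆ with 1 ≤? countTrue U
  ... | no  U≱1 = ≤-trans (≤-pred (≰⇒> U≱1)) z≤n
  ... | yes 1≤U = ≤-pred (begin
    suc (countTrue U)
      ≤⟨ ≰⇒> (λ tight → loose U (U⊆S , 1≤U , U<S , tight)) ⟩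
    countTrue (N U ∩ A)
      ≤⟨ countTrue-⊆-∪ (N U ∩ A) (N U ∩ (A ─ ⁅ v ⁆)) ⁅ v ⁆ split ⟩
    countTrue (N U ∩ (A ─ ⁅ v ⁆)) + countTrue ⁅ v ⁆
      ≡⟨ trans (cong (countTrue (N U ∩ (A ─ ⁅ v ⁆)) +_) (countTrue-⁅⁆ v)) (+-comm _ 1) ⟩
    suc (countTrue (N U ∩ (A ─ ⁅ v ⁆))) ∎)
    where
    open ≤-Reasoning
    U⊆S : U ⊆ S
    U⊆S x u = proj₁ (∧-elim (U⊆ x u))
    U<S : countTrue U < countTrue S
    U<S = ≤-trans
      (s≤s (countTrue-⊆ U (S ∖ i) λ x u →
        ∖-intro S (λ { refl → not-true (proj₂ (∧-elim {S x} (U⊆ x u))) (⁅⁆-intro x) }) (U⊆S x u)))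
      (countTrue-∖ S s)
    split : ∀ x → (N U ∩ A) x ≡ true → (N U ∩ (A ─ ⁅ v ⁆)) x ≡ true ⊎ ⁅ v ⁆ x ≡ true
    split x e with ⁅ v ⁆ x
    ... | true  = inj₂ refl
    ... | false = inj₁ (trans (cong (N U x ∧_) (Bool.∧-identityʳ (A x))) e)

  -- Halmos–Vaughan: match a tight proper subset first and then the rest; if there is none, match any
  -- element with any of its neighbours.
  matching : ∀ fuel S A → countTrue S ≤ fuel → HallCondition S A → Matching S A
  matching zero S A S≤0 hall =
    (λ _ → zero) , (λ i s → ⊥-elim (empty i s)) , (λ i j s → ⊥-elim (empty i s))
    where
    empty : ∀ i → S i ≢ true
    empty i s with ≤-trans (countTrue-∖ S s) S≤0
    ... | ()
  matching (suc fuel) S A S≤ hall with any? (λ i → S i Bool.≟ true)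
  ... | no empty = (λ _ → zero) , (λ i s → ⊥-elim (empty (i , s))) , (λ i j s → ⊥-elim (empty (i , s)))
  ... | yes (i , s) with anySubset? (λ T → tight? S A (lookup T))
  ... | yes (T′ , T-tight@(T⊆S , 1≤T , T<S , _)) =
    glue {S} {T} {A} {N T ∩ A} (λ v e → proj₂ (∧-elim {N T v} e)) (f , (λ j t → cong₂ _∧_ (N-intro T t (f j)) (f-in j t)) , f-inj)
      (matching fuel (S ─ T) (A ─ (N T ∩ A)) S─T≤ (hall-tight {S} {A} {T} hall T-tight))
    where
    T : Fin l → Bool
    T = lookup T′
    T-matching : Matching T A
    T-matching = matching fuel T A (≤-pred (≤-trans T<S S≤)) (λ U U⊆T → hall U (λ x u → T⊆S x (U⊆T x u)))
    f = proj₁ T-matching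
    f-in = proj₁ (proj₂ T-matching)
    f-inj = proj₂ (proj₂ T-matching)
    S─T≤ : countTrue (S ─ T) ≤ fuel
    S─T≤ = ≤-pred (begin
      suc (countTrue (S ─ T))           ≤⟨ +-monoˡ-≤ (countTrue (S ─ T)) 1≤T ⟩
      countTrue T + countTrue (S ─ T)
        ≤⟨ countTrue-disjoint T (S ─ T) S T⊆S (λ x e → proj₁ (∧-elim e))
             (λ x t e → not-true (proj₂ (∧-elim {S x} e)) t) ⟩
      countTrue S                       ≤⟨ S≤ ⟩
      suc fuel ∎)
      where open ≤-Reasoning
  ... | no loose with countTrue-positive (N ⁅ i ⁆ ∩ A)
          (≤-trans (≤-reflexive (sym (countTrue-⁅⁆ i))) (hall ⁅ i ⁆ λ x e → trans (cong S (⁅⁆-elim e)) s))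
  ... | v , e with N-elim ⁅ i ⁆ (proj₁ (∧-elim e))
  ... | j , j≡i , c , hjc≡v =
    glue {S} {⁅ i ⁆} {A} {⁅ v ⁆} (λ x x≡v → trans (cong A (⁅⁆-elim x≡v)) (proj₂ (∧-elim {N ⁅ i ⁆ v} e)))
      ((λ _ → c) , (λ x x≡i → trans (cong ⁅ v ⁆ (trans (cong (λ z → h z c) (trans (⁅⁆-elim x≡i) (sym (⁅⁆-elim j≡i)))) hjc≡v)) (⁅⁆-intro v)) ,
       λ x y x≡i y≡i _ → trans (⁅⁆-elim x≡i) (sym (⁅⁆-elim y≡i)))
      (matching fuel (S ─ ⁅ i ⁆) (A ─ ⁅ v ⁆) S─i≤
        (hall-loose {S} {A} hall (λ T t → loose (tabulateᵛ T , tight-cong (λ x → sym (lookup∘tabulate T x)) t)) s))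
    where
    S─i≤ : countTrue (S ─ ⁅ i ⁆) ≤ fuel
    S─i≤ = ≤-pred (≤-trans
      (s≤s (countTrue-⊆ (S ─ ⁅ i ⁆) (S ∖ i) λ x e′ →
        ∖-intro S (λ { refl → not-true (proj₂ (∧-elim {S x} e′)) (⁅⁆-intro x) }) (proj₁ (∧-elim e′))))
      (≤-trans (countTrue-∖ S s) S≤))

-- Averaging over all functions

∑ ∏ : (Fin n → ℕ) → ℕ
∑ {zero}  f = 0
∑ {suc n} f = f zero + ∑ (f ∘ suc)
∏ {zero}  f = 1
∏ {suc n} f = f zero * ∏ (f ∘ suc)

∑ₗ : {I : Set} → (I → ℕ) → List I → ℕ
∑ₗ f xs = sum (map f xs)

∑-zero : ∀ n → ∑ {n} (λ _ → 0) ≡ 0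
∑-zero zero    = refl
∑-zero (suc n) = ∑-zero n

∑-+ : (f g : Fin n → ℕ) → ∑ (λ e → f e + g e) ≡ ∑ f + ∑ g
∑-+ {zero}  f g = refl
∑-+ {suc n} f g = trans (cong ((f zero + g zero) +_) (∑-+ (f ∘ suc) (g ∘ suc))) (interchange (f zero) (g zero) _ _)

*-∑-* : ∀ a b (f : Fin n → ℕ) → ∑ (λ e → a * f e * b) ≡ a * (∑ f * b)
*-∑-* {zero}  a b f = sym (*-zeroʳ a)
*-∑-* {suc n} a b f = trans (cong (a * f zero * b +_) (*-∑-* a b (f ∘ suc))) (identity a (f zero) (∑ (f ∘ suc)) b)
  where
  open +-*-Solver
  identity : ∀ a x s b → a * x * b + a * (s * b) ≡ a * ((x + s) * b)
  identity = solve 4 (λ a x s b → a :* x :* b :+ a :* (s :* b) := a :* ((x :+ s) :* b)) refl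

∑ₗ-cong : {I : Set} {f g : I → ℕ} → (∀ i → f i ≡ g i) → ∀ xs → ∑ₗ f xs ≡ ∑ₗ g xs
∑ₗ-cong eq []       = refl
∑ₗ-cong eq (x ∷ xs) = cong₂ _+_ (eq x) (∑ₗ-cong eq xs)

∑-∑ₗ-swap : {I : Set} (f : I → Fin n → ℕ) (xs : List I) →
  ∑ (λ e → ∑ₗ (λ i → f i e) xs) ≡ ∑ₗ (λ i → ∑ (f i)) xs
∑-∑ₗ-swap {n} f []       = ∑-zero n
∑-∑ₗ-swap     f (x ∷ xs) = trans (∑-+ (f x) (λ e → ∑ₗ (λ i → f i e) xs)) (cong (∑ (f x) +_) (∑-∑ₗ-swap f xs))

below-average : .{{_ : NonZero n}} (f : Fin n → ℕ) → ∃ λ e → n * f e ≤ ∑ f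
below-average {suc zero}    f = zero , ≤-refl
below-average {suc (suc n)} f with below-average (f ∘ suc)
... | e , h with f zero ≤? f (suc e)
... | yes f₀≤ = zero , +-monoʳ-≤ (f zero) (≤-trans (*-monoʳ-≤ (suc n) f₀≤) h)
... | no  f₀≰ = suc e , +-mono-≤ (≰⇒≥ f₀≰) h

-- This is the method of conditional expectations. After division by `r ^ m` the right side is the
-- mean over all `g`, since the mean of a product over independent coordinates factorises.
-- Coordinates are fixed one at a time at a value not above the average, and `a` collects the
-- factors already fixed.
choose : ∀ m .{{_ : NonZero r}} {I : Set} (xs : List I) (a : I → ℕ) (f : I → Fin m → Fin r → ℕ) →
  ∃ λ (g : Fin m → Fin r) →
    r ^ m * ∑ₗ (λ i → a i * ∏ (λ l → f i l (g l))) xs ≤ ∑ₗ (λ i → a i * ∏ (λ l → ∑ (f i l))) xs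
choose zero xs a f = (λ ()) , ≤-reflexive (*-identityˡ _)
choose {r} (suc m) {I} xs a f = cons e g , (begin
  r * r ^ m * ∑ₗ (λ i → a i * (f i zero e * ∏ (λ l → f i (suc l) (g l)))) xs
    ≡⟨ cong (r * r ^ m *_) (∑ₗ-cong (λ i → *-assoc (a i) (f i zero e) _) xs) ⟨
  r * r ^ m * ∑ₗ (λ i → a i * f i zero e * ∏ (λ l → f i (suc l) (g l))) xs
    ≡⟨ *-assoc r (r ^ m) _ ⟩
  r * (r ^ m * ∑ₗ (λ i → a i * f i zero e * ∏ (λ l → f i (suc l) (g l))) xs)
    ≤⟨ *-monoʳ-≤ r g-good ⟩
  r * F e
    ≤⟨ e-good ⟩
  ∑ F
    ≡⟨ ∑-∑ₗ-swap (λ i e → a i * f i zero e * rest i) xs ⟩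
  ∑ₗ (λ i → ∑ (λ e → a i * f i zero e * rest i)) xs
    ≡⟨ ∑ₗ-cong (λ i → *-∑-* (a i) (rest i) (f i zero)) xs ⟩
  ∑ₗ (λ i → a i * (∑ (f i zero) * rest i)) xs ∎)
  where
  open ≤-Reasoning
  cons : {A : Set} → A → (Fin m → A) → Fin (suc m) → A
  cons x g zero    = x
  cons x g (suc l) = g l
  rest : I → ℕ
  rest i = ∏ (λ l → ∑ (f i (suc l)))
  F : Fin r → ℕ
  F e = ∑ₗ (λ i → a i * f i zero e * rest i) xs
  e = proj₁ (below-average F)
  e-good = proj₂ (below-average F)
  tail = choose m xs (λ i → a i * f i zero e) (λ i l → f i (suc l))
  g = proj₁ tail
  g-good = proj₂ tail

-- Subsets of a given size

_◂_ : Bool → (Fin n → Bool) → Fin (suc n) → Bool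
(b ◂ p) zero    = b
(b ◂ p) (suc x) = p x

subsets : (n m : ℕ) → List (Fin n → Bool)
subsets n       zero    = (λ _ → false) ∷ []
subsets zero    (suc m) = []
subsets (suc n) (suc m) = map (true ◂_) (subsets n m) ++ map (false ◂_) (subsets n (suc m))

subsets-count : (n m : ℕ) → All (λ p → countTrue p ≡ m) (subsets n m)
subsets-count n       zero    = countTrue-false {n} _ (λ _ → refl) ∷ []
subsets-count zero    (suc m) = []
subsets-count (suc n) (suc m) = All.++⁺
  (All.map⁺ (All.map (cong suc) (subsets-count n m)))
  (All.map⁺ (subsets-count n (suc m)))

subsets-complete : (n m : ℕ) (p : Fin n → Bool) → countTrue p ≡ m → Any (p ≗_) (subsets n m)
subsets-complete n zero p eq = here false-everywhere
  where
  false-everywhere : ∀ x → p x ≡ false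
  false-everywhere x with p x in px
  ... | false = refl
  ... | true  = contradiction (≤-trans (countTrue-∖ p px) (≤-reflexive eq)) λ ()
subsets-complete (suc n) (suc m) p eq with p zero in p0
... | true  = Any.++⁺ˡ (Any.map⁺ (Any.map (λ { h zero → p0 ; h (suc x) → h x })
                (subsets-complete n m (p ∘ suc) (cong pred eq))))
... | false = Any.++⁺ʳ _ (Any.map⁺ (Any.map (λ { h zero → p0 ; h (suc x) → h x })
                (subsets-complete n (suc m) (p ∘ suc) eq)))

-- These are the two leading terms of the binomial expansion; they turn Pascal's rule into the
-- induction step of `length-subsets`.
binomial-lower : ∀ x m → x ^ suc m + suc m * x ^ m ≤ suc x ^ suc m
binomial-lower x zero    = ≤-reflexive (identity x)
  where
  open +-*-Solver
  identity : ∀ x → x * 1 + 1 * 1 ≡ suc x * 1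
  identity = solve 1 (λ x → x :* con 1 :+ con 1 := (con 1 :+ x) :* con 1) refl
binomial-lower x (suc m) = begin
  x ^ suc (suc m) + suc (suc m) * x ^ suc m
    ≤⟨ m≤m+n _ (suc m * x ^ m) ⟩
  x ^ suc (suc m) + suc (suc m) * x ^ suc m + suc m * x ^ m
    ≡⟨ identity x (x ^ m) m ⟩
  suc x * (x ^ suc m + suc m * x ^ m)
    ≤⟨ *-monoʳ-≤ (suc x) (binomial-lower x m) ⟩
  suc x ^ suc (suc m) ∎
  where
  open ≤-Reasoning
  identity : ∀ x y m → x * (x * y) + suc (suc m) * (x * y) + suc m * y ≡ suc x * (x * y + suc m * y)
  identity = solve 3 (λ x y m → x :* (x :* y) :+ (con 2 :+ m) :* (x :* y) :+ (con 1 :+ m) :* y :=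
    (con 1 :+ x) :* (x :* y :+ (con 1 :+ m) :* y)) refl
    where open +-*-Solver

-- This is the mean value bound on the increment of a power, with the derivative taken at the right
-- end.
binomial-upper : ∀ x m → suc x ^ suc m ≤ x ^ suc m + suc m * suc x ^ m
binomial-upper x zero    = ≤-reflexive (identity x)
  where
  open +-*-Solver
  identity : ∀ x → suc x * 1 ≡ x * 1 + 1 * 1
  identity = solve 1 (λ x → (con 1 :+ x) :* con 1 := x :* con 1 :+ con 1) refl
binomial-upper x (suc m) = begin
  suc x * suc x ^ suc m
    ≤⟨ *-monoʳ-≤ (suc x) (binomial-upper x m) ⟩
  suc x * (x ^ suc m + suc m * suc x ^ m)
    ≡⟨ identity x (x ^ suc m) (suc x ^ m) m ⟩
  x * x ^ suc m + (x ^ suc m + suc m * suc x ^ suc m)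
    ≤⟨ +-monoʳ-≤ (x * x ^ suc m) (+-monoˡ-≤ _ (^-monoˡ-≤ (suc m) (n≤1+n x))) ⟩
  x ^ suc (suc m) + suc (suc m) * suc x ^ suc m ∎
  where
  open ≤-Reasoning
  identity : ∀ x y z m → suc x * (y + suc m * z) ≡ x * y + (y + suc m * (suc x * z))
  identity = solve 4 (λ x y z m → (con 1 :+ x) :* (y :+ (con 1 :+ m) :* z) :=
    x :* y :+ (y :+ (con 1 :+ m) :* ((con 1 :+ x) :* z))) refl
    where open +-*-Solver

length-subsets : (n m : ℕ) → length (subsets n m) * m ! ≤ n ^ m
length-subsets n       zero    = ≤-refl
length-subsets zero    (suc m) = z≤n
length-subsets (suc n) (suc m) = begin
  length (subsets (suc n) (suc m)) * suc m !
    ≡⟨ cong (_* suc m !) (trans (length-++ (map (true ◂_) (subsets n m)))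
         (cong₂ _+_ (length-map _ (subsets n m)) (length-map _ (subsets n (suc m))))) ⟩
  (length (subsets n m) + length (subsets n (suc m))) * suc m !
    ≡⟨ identity (length (subsets n m)) (length (subsets n (suc m))) (m !) m ⟩
  length (subsets n (suc m)) * suc m ! + suc m * (length (subsets n m) * m !)
    ≤⟨ +-mono-≤ (length-subsets n (suc m)) (*-monoʳ-≤ (suc m) (length-subsets n m)) ⟩
  n ^ suc m + suc m * n ^ m
    ≤⟨ binomial-lower n m ⟩
  suc n ^ suc m ∎
  where
  open ≤-Reasoning
  identity : ∀ a b f m → (a + b) * (suc m * f) ≡ b * (suc m * f) + suc m * (a * f)
  identity = solve 4 (λ a b f m → (a :+ b) :* ((con 1 :+ m) :* f) :=
    b :* ((con 1 :+ m) :* f) :+ (con 1 :+ m) :* (a :* f)) refl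
    where open +-*-Solver

shrink : (p : Fin n → Bool) → m ≤ countTrue p → ∃ λ q → q ⊆ p × countTrue q ≡ m
shrink {n} {zero} p _ = (λ _ → false) , (λ _ ()) , countTrue-false {n} _ (λ _ → refl)
shrink {suc n} {suc m} p h with p zero in p0
... | true  with shrink (p ∘ suc) (≤-pred h)
... | q , q⊆p , eq = true ◂ q , (λ { zero _ → p0 ; (suc x) → q⊆p x }) , cong suc eq
shrink {suc n} {suc m} p h | false with shrink (p ∘ suc) h
... | q , q⊆p , eq = false ◂ q , (λ { zero () ; (suc x) → q⊆p x }) , eq

-- x^m / m! is at most a binomial coefficient of x + m.
power≤factorial : ∀ x m → x ^ m ≤ m ! * 2 ^ (x + m)
power≤factorial x       zero    = ≤-trans (m^n>0 2 (x + 0)) (≤-reflexive (sym (*-identityˡ _)))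
power≤factorial zero    (suc m) = z≤n
power≤factorial (suc x) (suc m) = begin
  suc x ^ suc m
    ≤⟨ binomial-upper x m ⟩
  x ^ suc m + suc m * suc x ^ m
    ≤⟨ +-mono-≤ (power≤factorial x (suc m)) (*-monoʳ-≤ (suc m) (power≤factorial (suc x) m)) ⟩
  suc m ! * 2 ^ (x + suc m) + suc m * (m ! * 2 ^ (suc x + m))
    ≡⟨ cong (λ e → suc m ! * 2 ^ e + suc m * (m ! * 2 ^ (suc x + m))) (+-suc x m) ⟩
  suc m ! * 2 ^ (suc x + m) + suc m * (m ! * 2 ^ (suc x + m))
    ≡⟨ identity m (m !) (2 ^ (suc x + m)) ⟩
  suc m ! * (2 * 2 ^ (suc x + m))
    ≡⟨ cong (λ e → suc m ! * 2 ^ suc e) (+-suc x m) ⟨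
  suc m ! * 2 ^ (suc x + suc m) ∎
  where
  open ≤-Reasoning
  identity : ∀ m f y → suc m * f * y + suc m * (f * y) ≡ suc m * f * (2 * y)
  identity = solve 3 (λ m f y → (con 1 :+ m) :* f :* y :+ (con 1 :+ m) :* (f :* y) :=
    (con 1 :+ m) :* f :* (con 2 :* y)) refl
    where open +-*-Solver

-- The first moment estimate

^-distribʳ-* : ∀ o m n → (m * n) ^ o ≡ m ^ o * n ^ o
^-distribʳ-* zero    m n = refl
^-distribʳ-* (suc o) m n = trans (cong (m * n *_) (^-distribʳ-* o m n)) (*-interchange m n (m ^ o) (n ^ o))
  where
  open +-*-Solver
  *-interchange : ∀ a b c d → (a * b) * (c * d) ≡ (a * c) * (b * d)
  *-interchange = solve 4 (λ a b c d → (a :* b) :* (c :* d) := (a :* c) :* (b :* d)) refl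

-- It is meant for `t` = 2^v, `R` = places^v, `f` = v!, `y` = v^v and `κ` = k^v. Of the three
-- factors v^v, one is bounded by k^v, and the other two by v! 4^v each, which pays for the two
-- factorials in the counts of subsets.
*-factors-≤ : ∀ t R f y κ v → y ≤ f * (t * t) → y ≤ κ →
  (2 * t) * R * (v * y) ^ 3 ≤ (2 * v ^ 3) * (t ^ 5 * κ * R * (f * f))
*-factors-≤ t R f y κ v y≤f y≤κ = begin
  (2 * t) * R * (v * y) ^ 3
    ≡⟨ solve 4 (λ t R y v → (con 2 :* t) :* R :* (v :* y) :^ 3 :=
         (con 2 :* v :^ 3) :* (t :* R) :* (y :* (y :* y))) refl t R y v ⟩
  (2 * v ^ 3) * (t * R) * (y * (y * y))
    ≤⟨ *-monoʳ-≤ ((2 * v ^ 3) * (t * R)) (*-mono-≤ y≤κ (*-mono-≤ y≤f y≤f)) ⟩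
  (2 * v ^ 3) * (t * R) * (κ * ((f * (t * t)) * (f * (t * t))))
    ≡⟨ solve 5 (λ t R f κ v → (con 2 :* v :^ 3) :* (t :* R) :* (κ :* ((f :* (t :* t)) :* (f :* (t :* t)))) :=
         (con 2 :* v :^ 3) :* (t :^ 5 :* κ :* R :* (f :* f))) refl t R f κ v ⟩
  (2 * v ^ 3) * (t ^ 5 * κ * R * (f * f)) ∎
  where
  open ≤-Reasoning
  open +-*-Solver

module _ (k b : ℕ) .{{_ : NonZero k}} .{{_ : NonZero b}} where

  -- The 8 is 2³: as b ≥ 1, n < k (b + 1)³ ≤ 8 k b³, so the rows of length `b` have room for all
  -- inputs. The 16 makes `places ^ 3` divided by `rows` equal to 32 k `places`; this quotient is
  -- `κ`.
  rows places : ℕ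
  rows   = 8 * (k * (b * b))
  places = 16 * (k * b)

  private
    κ : ℕ
    κ = 512 * (k * k * b)

  places³ : places ^ 3 ≡ κ * rows
  places³ = solve 2 (λ k b → (con 16 :* (k :* b)) :^ 3 := (con 512 :* (k :* k :* b)) :* (con 8 :* (k :* (b :* b)))) refl k b
    where open +-*-Solver

  -- One factor `κ` is set aside for the 2 v³ left over in the estimate. In each of the others, 32 =
  -- 2⁵ pays 2⁴ for the two bounds v^v ≤ v! 4^v and 2 for the geometric decay, k pays for the third
  -- v^v, and `places` for the choice of V.
  κ-power : ∀ v → κ ^ suc v ≡ κ * ((2 ^ v) ^ 5 * k ^ v * places ^ v)
  κ-power v = cong (κ *_) (begin
    κ ^ v
      ≡⟨ cong (_^ v) (solve 2 (λ k b → con 512 :* (k :* k :* b) := con 32 :* k :* (con 16 :* (k :* b))) refl k b) ⟩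
    (32 * k * places) ^ v
      ≡⟨ ^-distribʳ-* v (32 * k) places ⟩
    (32 * k) ^ v * places ^ v
      ≡⟨ cong (_* places ^ v) (^-distribʳ-* v 32 k) ⟩
    32 ^ v * k ^ v * places ^ v
      ≡⟨ cong (λ t → t * k ^ v * places ^ v) (trans (^-*-assoc 2 5 v)
           (trans (cong (2 ^_) (*-comm 5 v)) (sym (^-*-assoc 2 v 5)))) ⟩
    (2 ^ v) ^ 5 * k ^ v * places ^ v ∎)
    where
    open ≡-Reasoning
    open +-*-Solver

  2v³≤κ : ∀ {v} → v ≤ k → 2 * v ^ 3 ≤ κ * suc v
  2v³≤κ {v} v≤k = begin
    2 * v ^ 3
      ≡⟨ solve 1 (λ v → con 2 :* v :^ 3 := con 2 :* (v :* v) :* v) refl v ⟩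
    2 * (v * v) * v
      ≤⟨ *-mono-≤ (*-mono-≤ (m≤m+n 2 510) (≤-trans (*-mono-≤ v≤k v≤k) (m≤m*n (k * k) b))) (n≤1+n v) ⟩
    κ * suc v ∎
    where
    open ≤-Reasoning
    open +-*-Solver

  -- The expected number of pairs (V , S), |V| = v and |S| = v + 1, such that all 3(v + 1) hash values of S
  -- fall into V is at most 2^-(v + 1); c₁ and c₂ stand for the numbers of such V and S.
  expectation : ∀ {v} c₁ c₂ → v ≤ k → c₁ * v ! ≤ places ^ v → c₂ * suc v ! ≤ rows ^ suc v →
    2 ^ suc v * (c₁ * c₂ * v ^ (suc v * 3)) ≤ places ^ (suc v * 3)
  expectation {v} c₁ c₂ v≤k h₁ h₂ = *-cancelʳ-≤ _ _ (v ! * suc v !)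
    {{m*n≢0 (v !) (suc v !) {{v !≢0}} {{suc v !≢0}}}} (begin
    2 ^ suc v * (c₁ * c₂ * v ^ (suc v * 3)) * (v ! * suc v !)
      ≡⟨ solve 6 (λ t c₁ c₂ w f g → t :* (c₁ :* c₂ :* w) :* (f :* g) := t :* (c₁ :* f) :* w :* (c₂ :* g)) refl
           (2 ^ suc v) c₁ c₂ (v ^ (suc v * 3)) (v !) (suc v !) ⟩
    2 ^ suc v * (c₁ * v !) * v ^ (suc v * 3) * (c₂ * suc v !)
      ≤⟨ *-mono-≤ (*-monoˡ-≤ (v ^ (suc v * 3)) (*-monoʳ-≤ (2 ^ suc v) h₁)) h₂ ⟩
    2 ^ suc v * places ^ v * v ^ (suc v * 3) * rows ^ suc v
      ≡⟨ cong (λ w → 2 ^ suc v * places ^ v * w * rows ^ suc v) (sym (^-*-assoc v (suc v) 3)) ⟩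
    2 ^ suc v * places ^ v * (v ^ suc v) ^ 3 * rows ^ suc v
      ≤⟨ *-monoˡ-≤ (rows ^ suc v) (*-factors-≤ (2 ^ v) (places ^ v) (v !) (v ^ v) (k ^ v) v
           (≤-trans (power≤factorial v v) (≤-reflexive (cong (v ! *_) (^-distribˡ-+-* 2 v v)))) (^-monoˡ-≤ v v≤k)) ⟩
    2 * v ^ 3 * ((2 ^ v) ^ 5 * k ^ v * places ^ v * (v ! * v !)) * rows ^ suc v
      ≤⟨ *-monoˡ-≤ (rows ^ suc v) (*-monoˡ-≤ ((2 ^ v) ^ 5 * k ^ v * places ^ v * (v ! * v !)) (2v³≤κ v≤k)) ⟩
    κ * suc v * ((2 ^ v) ^ 5 * k ^ v * places ^ v * (v ! * v !)) * rows ^ suc v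
      ≡⟨ solve 5 (λ κ s w f r → κ :* s :* (w :* (f :* f)) :* r := κ :* w :* r :* (f :* (s :* f))) refl
           κ (suc v) ((2 ^ v) ^ 5 * k ^ v * places ^ v) (v !) (rows ^ suc v) ⟩
    κ * ((2 ^ v) ^ 5 * k ^ v * places ^ v) * rows ^ suc v * (v ! * suc v !)
      ≡⟨ cong (λ w → w * rows ^ suc v * (v ! * suc v !)) (κ-power v) ⟨
    κ ^ suc v * rows ^ suc v * (v ! * suc v !)
      ≡⟨ cong (_* (v ! * suc v !)) (trans (sym (^-distribʳ-* (suc v) κ rows)) (cong (_^ suc v) (sym places³))) ⟩
    (places ^ 3) ^ suc v * (v ! * suc v !)
      ≡⟨ cong (_* (v ! * suc v !)) (trans (^-*-assoc places 3 (suc v)) (cong (places ^_) (*-comm 3 (suc v)))) ⟩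
    places ^ (suc v * 3) * (v ! * suc v !) ∎)
    where
    open ≤-Reasoning
    open +-*-Solver

-- Hash functions that confine no few rows to fewer places

∑-ones : ∀ n → ∑ {n} (λ _ → 1) ≡ n
∑-ones zero    = refl
∑-ones (suc n) = cong suc (∑-ones n)

∑-bit : (p : Fin n → Bool) → ∑ (bit ∘ p) ≡ countTrue p
∑-bit {zero}  p = refl
∑-bit {suc n} p = cong (bit (p zero) +_) (∑-bit (p ∘ suc))

∏-cong : {f g : Fin n → ℕ} → (∀ x → f x ≡ g x) → ∏ f ≡ ∏ g
∏-cong {zero}  eq = refl
∏-cong {suc n} eq = cong₂ _*_ (eq zero) (∏-cong (eq ∘ suc))

∏-one : (f : Fin n → ℕ) → (∀ x → f x ≡ 1) → ∏ f ≡ 1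
∏-one {zero}  f eq = refl
∏-one {suc n} f eq = cong₂ _*_ (eq zero) (∏-one (f ∘ suc) (eq ∘ suc))

-- Cross-multiplied, to avoid subtracting in the exponent of b.
∏-if : (S : Fin n → Bool) (a b : ℕ) →
  ∏ (λ x → if S x then a else b) * b ^ countTrue S ≡ a ^ countTrue S * b ^ n
∏-if {zero}  S a b = refl
∏-if {suc n} S a b with S zero
... | true  = trans (identity a (∏ rest) b (b ^ s)) (trans (cong (a * b *_) (∏-if (S ∘ suc) a b)) (identity′ a b (a ^ s) (b ^ n)))
  where
  open +-*-Solver
  rest : Fin n → ℕ
  rest x = if S (suc x) then a else b
  s = countTrue (S ∘ suc)
  identity : ∀ a p b q → a * p * (b * q) ≡ a * b * (p * q)
  identity = solve 4 (λ a p b q → a :* p :* (b :* q) := a :* b :* (p :* q)) refl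
  identity′ : ∀ a b p q → a * b * (p * q) ≡ a * p * (b * q)
  identity′ = solve 4 (λ a b p q → a :* b :* (p :* q) := a :* p :* (b :* q)) refl
... | false = trans (*-assoc b _ _) (trans (cong (b *_) (∏-if (S ∘ suc) a b)) (identity b (a ^ s) (b ^ n)))
  where
  open +-*-Solver
  s = countTrue (S ∘ suc)
  identity : ∀ b p q → b * (p * q) ≡ p * (b * q)
  identity = solve 3 (λ b p q → b :* (p :* q) := p :* (b :* q)) refl

countTrue-quotient : (S : Fin l → Bool) → countTrue (S ∘ quotient {l} 3) ≡ countTrue S * 3
countTrue-quotient {zero}  S = refl
countTrue-quotient {suc l} S with S zero
... | true  = cong (3 +_) (countTrue-quotient (S ∘ suc))
... | false = countTrue-quotient (S ∘ suc)

length-cartesianProduct : {A B : Set} (xs : List A) (ys : List B) →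
  length (cartesianProduct xs ys) ≡ length xs * length ys
length-cartesianProduct []       ys = refl
length-cartesianProduct (x ∷ xs) ys = trans (length-++ (map (x ,_) ys))
  (cong₂ _+_ (length-map (x ,_) ys) (length-cartesianProduct xs ys))

∑ₗ-++ : {I : Set} (f : I → ℕ) (xs ys : List I) → ∑ₗ f (xs ++ ys) ≡ ∑ₗ f xs + ∑ₗ f ys
∑ₗ-++ f xs ys = trans (cong sum (map-++ f xs ys)) (sum-++ (map f xs) (map f ys))

∑ₗ-member : {I : Set} (f : I → ℕ) {xs : List I} → Any (λ i → 1 ≤ f i) xs → 1 ≤ ∑ₗ f xs
∑ₗ-member f (here h)           = ≤-trans h (m≤m+n _ _)
∑ₗ-member f (there {x = x} h) = ≤-trans (∑ₗ-member f h) (m≤n+m _ (f x))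

Pair : ℕ → ℕ → Set
Pair l r = (Fin r → Bool) × (Fin l → Bool)

-- A function g : Fin (l * 3) → Fin r maps the positions of S into U exactly if ∏ (λ j → hit (U , S) j (g j)) ≡ 1.
hit : Pair l r → Fin (l * 3) → Fin r → ℕ
hit (U , S) j e = if S (quotient 3 j) then bit (U e) else 1

-- By the product rule this is the number of functions `Fin (l * 3) → Fin r` that map all positions
-- of the rows in the second set into the first set.
hits : Pair l r → ℕ
hits p = ∏ (λ j → ∑ (hit p j))

hits-count : (p : Pair l r) → let U , S = p ; s = countTrue S * 3 in
  hits p * r ^ s ≡ countTrue U ^ s * r ^ (l * 3)
hits-count {l} {r} (U , S) = subst (λ s → hits (U , S) * r ^ s ≡ countTrue U ^ s * r ^ (l * 3))
  (countTrue-quotient S)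
  (trans (cong (_* r ^ countTrue (S ∘ quotient {l} 3)) (∏-cong sum-hit)) (∏-if (S ∘ quotient 3) (countTrue U) r))
  where
  sum-hit : ∀ j → ∑ (hit (U , S) j) ≡ (if S (quotient 3 j) then countTrue U else r)
  sum-hit j with S (quotient 3 j)
  ... | true  = ∑-bit U
  ... | false = ∑-ones r

level : (l r v : ℕ) → List (Pair l r)
level l r v = cartesianProduct (subsets r v) (subsets l (suc v))

levels : (l r k : ℕ) → List (Pair l r)
levels l r zero    = []
levels l r (suc k) = level l r k ++ levels l r k

levels-member : ∀ {P : Pair l r → Set} {v k} → v < k → Any P (level l r v) → Any P (levels l r k)
levels-member {l} {r} {v = v} {suc k} (s≤s v≤k) h with v ≟ℕ k
... | yes refl = Any.++⁺ˡ h
... | no  v≢k  = Any.++⁺ʳ (level l r k) (levels-member (≤∧≢⇒< v≤k v≢k) h)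

level-hits : ∀ v → ∑ₗ hits (level l r v) * r ^ (suc v * 3) ≡
  length (subsets r v) * length (subsets l (suc v)) * v ^ (suc v * 3) * r ^ (l * 3)
level-hits {l} {r} v = trans (scale (level l r v) all-hits)
  (cong (λ c → c * v ^ (suc v * 3) * r ^ (l * 3)) (length-cartesianProduct (subsets r v) (subsets l (suc v))))
  where
  all-hits : All (λ p → hits p * r ^ (suc v * 3) ≡ v ^ (suc v * 3) * r ^ (l * 3)) (level l r v)
  all-hits = All.tabulate λ {p} p∈ →
    let U∈ , S∈ = ∈-cartesianProduct⁻ (subsets r v) (subsets l (suc v)) p∈
    in subst₂ (λ u s → hits p * r ^ (s * 3) ≡ u ^ (s * 3) * r ^ (l * 3))
         (All.lookup (subsets-count r v) U∈) (All.lookup (subsets-count l (suc v)) S∈) (hits-count p)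
  scale : ∀ {x y z} (ps : List (Pair l r)) → All (λ p → hits p * x ≡ y * z) ps → ∑ₗ hits ps * x ≡ length ps * y * z
  scale []       []         = refl
  scale {x} {y} {z} (p ∷ ps) (eq ∷ eqs) = begin
    (hits p + ∑ₗ hits ps) * x        ≡⟨ *-distribʳ-+ x (hits p) _ ⟩
    hits p * x + ∑ₗ hits ps * x      ≡⟨ cong₂ _+_ eq (scale ps eqs) ⟩
    y * z + length ps * y * z        ≡⟨ *-distribʳ-+ z y (length ps * y) ⟨
    length (p ∷ ps) * y * z          ∎
    where open ≡-Reasoning

-- This is 1/2 + 1/4 + ... + 1/2^k = 1 - 1/2^k after multiplication by `2 ^ k`. The extra `B` on the
-- left is the slack that makes the total strictly smaller than `B`.
geometric : ∀ {B} k → (∀ v → v < k → 2 ^ suc v * ∑ₗ hits (level l r v) ≤ B) →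
  2 ^ k * ∑ₗ hits (levels l r k) + B ≤ 2 ^ k * B
geometric {B = B} zero h = ≤-reflexive (sym (+-identityʳ B))
geometric {l} {r} {B} (suc k) h = begin
  2 ^ suc k * ∑ₗ hits (level l r k ++ levels l r k) + B
    ≡⟨ cong (λ x → 2 ^ suc k * x + B) (∑ₗ-++ hits (level l r k) (levels l r k)) ⟩
  2 ^ suc k * (∑ₗ hits (level l r k) + ∑ₗ hits (levels l r k)) + B
    ≡⟨ solve 4 (λ t x y B → con 2 :* t :* (x :+ y) :+ B := con 2 :* t :* x :+ (con 2 :* (t :* y) :+ B)) refl
         (2 ^ k) (∑ₗ hits (level l r k)) (∑ₗ hits (levels l r k)) B ⟩
  2 ^ suc k * ∑ₗ hits (level l r k) + (2 * (2 ^ k * ∑ₗ hits (levels l r k)) + B)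
    ≤⟨ +-monoˡ-≤ _ (h k ≤-refl) ⟩
  B + (2 * (2 ^ k * ∑ₗ hits (levels l r k)) + B)
    ≡⟨ solve 2 (λ B x → B :+ (con 2 :* x :+ B) := con 2 :* (x :+ B)) refl B (2 ^ k * ∑ₗ hits (levels l r k)) ⟩
  2 * (2 ^ k * ∑ₗ hits (levels l r k) + B)
    ≤⟨ *-monoʳ-≤ 2 (geometric k (λ v v<k → h v (m≤n⇒m≤1+n v<k))) ⟩
  2 * (2 ^ k * B)
    ≡⟨ *-assoc 2 (2 ^ k) B ⟨
  2 ^ suc k * B ∎
  where
  open ≤-Reasoning
  open +-*-Solver

-- The mean number of pairs hit is below 1, so some `g` hits none. If `T` had too few neighbours,
-- then `N T`, of size v < k, together with any v + 1 rows of `T` would be a pair that is hit.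
expander : ∀ {k} .{{_ : NonZero r}} →
  (∀ v → v < k → 2 ^ suc v * ∑ₗ hits (level l r v) ≤ r ^ (l * 3)) →
  ∃ λ (h : Fin l → Fin 3 → Fin r) → ∀ T → countTrue T ≤ k → countTrue T ≤ countTrue (Hall.N h T)
expander {r} {l} {k} few = h , expands
  where
  open ≤-Reasoning
  B = r ^ (l * 3)
  ps = levels l r k
  hash = choose (l * 3) ps (λ _ → 1) hit
  g = proj₁ hash
  h : Fin l → Fin 3 → Fin r
  h i c = g (combine i c)
  open Hall h
  hits-g : Pair l r → ℕ
  hits-g p = 1 * ∏ (λ j → hit p j (g j))
  hits< : ∑ₗ hits ps < B
  hits< = *-cancelˡ-< (2 ^ k) _ _ (begin
    suc (2 ^ k * ∑ₗ hits ps)     ≡⟨ +-comm 1 _ ⟩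
    2 ^ k * ∑ₗ hits ps + 1       ≤⟨ +-monoʳ-≤ _ (m^n>0 r (l * 3)) ⟩
    2 ^ k * ∑ₗ hits ps + B       ≤⟨ geometric k few ⟩
    2 ^ k * B                    ∎)
  no-hit : ¬ (1 ≤ ∑ₗ hits-g ps)
  no-hit hit≥1 = <⇒≱ hits< (begin
    B                            ≡⟨ *-identityʳ B ⟨
    B * 1                        ≤⟨ *-monoʳ-≤ B hit≥1 ⟩
    B * ∑ₗ hits-g ps             ≤⟨ proj₂ hash ⟩
    ∑ₗ (λ p → 1 * hits p) ps     ≡⟨ ∑ₗ-cong (λ p → *-identityˡ (hits p)) ps ⟩
    ∑ₗ hits ps                   ∎)
  expands : ∀ T → countTrue T ≤ k → countTrue T ≤ countTrue (N T)
  expands T T≤k with countTrue T ≤? countTrue (N T)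
  ... | yes T≤N = T≤N
  ... | no  T≰N with shrink T (≰⇒> T≰N)
  ... | S , S⊆T , S≡ = contradiction (∑ₗ-member hits-g (levels-member (≤-trans (≰⇒> T≰N) T≤k) (Any.map hit-one
        (Any.cartesianProduct⁺ (subsets-complete r (countTrue (N T)) (N T) refl) (subsets-complete l _ S S≡))))) no-hit
    where
    hit-one : ∀ {p} → N T ≗ proj₁ p × S ≗ proj₂ p → 1 ≤ hits-g p
    hit-one {p} (eqU , eqS) = ≤-reflexive (sym (trans (*-identityˡ _) (∏-one _ one)))
      where
      one : ∀ j → hit p j (g j) ≡ 1
      one j with proj₂ p (quotient 3 j) in Sj
      ... | false = refl
      ... | true  = cong bit (trans (sym (eqU (g j))) (subst (λ e → N T (g e) ≡ true) (combine-remQuot {l} 3 j)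
            (N-intro T (S⊆T (quotient 3 j) (trans (eqS (quotient 3 j)) Sj)) (remainder {l} 3 j))))

hashing : ∀ k b .{{_ : NonZero k}} .{{_ : NonZero b}} →
  ∃ λ (h : Fin (rows k b) → Fin 3 → Fin (places k b)) →
    ∀ T → countTrue T ≤ k → countTrue T ≤ countTrue (Hall.N h T)
hashing k b = expander few
  where
  R = places k b
  L = rows k b
  instance
    R≢0 : NonZero R
    R≢0 = m*n≢0 16 (k * b) {{_}} {{m*n≢0 k b}}
  few : ∀ v → v < k → 2 ^ suc v * ∑ₗ hits (level L R v) ≤ R ^ (L * 3)
  few v v<k = *-cancelʳ-≤ _ _ (R ^ (suc v * 3)) {{m^n≢0 R (suc v * 3)}} (begin
    2 ^ suc v * ∑ₗ hits (level L R v) * R ^ (suc v * 3)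
      ≡⟨ *-assoc (2 ^ suc v) _ _ ⟩
    2 ^ suc v * (∑ₗ hits (level L R v) * R ^ (suc v * 3))
      ≡⟨ cong (2 ^ suc v *_) (level-hits v) ⟩
    2 ^ suc v * (length (subsets R v) * length (subsets L (suc v)) * v ^ (suc v * 3) * R ^ (L * 3))
      ≡⟨ *-assoc (2 ^ suc v) _ _ ⟨
    2 ^ suc v * (length (subsets R v) * length (subsets L (suc v)) * v ^ (suc v * 3)) * R ^ (L * 3)
      ≤⟨ *-monoˡ-≤ (R ^ (L * 3)) (expectation k b (length (subsets R v)) (length (subsets L (suc v))) (<⇒≤ v<k) (length-subsets R v) (length-subsets L (suc v))) ⟩
    R ^ (suc v * 3) * R ^ (L * 3)
      ≡⟨ *-comm (R ^ (suc v * 3)) _ ⟩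
    R ^ (L * 3) * R ^ (suc v * 3) ∎)
    where open ≤-Reasoning

-- The encoding obtained from an expanding hash function

module Grid {n l b r k : ℕ} (h : Fin l → Fin 3 → Fin r)
  (expands : ∀ T → countTrue T ≤ k → countTrue T ≤ countTrue (Hall.N h T))
  (cell : Fin n → Fin (l * b)) (cell-injective : ∀ {x y} → cell x ≡ cell y → x ≡ y) where

  open Hall h

  row : Fin n → Fin l
  row x = quotient b (cell x)

  column : Fin n → Fin b
  column x = remainder {l} b (cell x)

  Variable : Set
  Variable = (Fin n ⊎ Fin (l * 3)) ⊎ Fin (r * b)

  input : Fin n → Variable
  input x = inj₁ (inj₁ x)

  selected : Fin l → Fin 3 → Variable
  selected i c = inj₁ (inj₂ (combine i c))

  slot : Fin 3 → Fin n → Fin (r * b)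
  slot c x = combine (h (row x) c) (column x)

  place : Fin (l * 3) → Fin r
  place e = h (quotient 3 e) (remainder {l} 3 e)

  place-combine : ∀ i c → place (combine i c) ≡ h i c
  place-combine i c = cong (λ p → h (proj₁ p) (proj₂ p)) (remQuot-combine i c)

  selection : Fin n → Fin 3 → Lit Variable
  selection x c = pos (selected (row x) c)

  some-selected : Fin n → Clause Variable
  some-selected x = neg (input x) ∷ tabulate (selection x)

  copied : Fin n → Fin 3 → Clause Variable
  copied x c = neg (input x) ∷ neg (selected (row x) c) ∷ pos (inj₂ (slot c x)) ∷ []

  copying : CNF Variable
  copying = tabulate some-selected ++ tabulate {n = n * 3} (λ e → copied (quotient 3 e) (remainder {n} 3 e))

  size-copying : size copying ≡ n + n * 3
  size-copying = trans (length-++ (tabulate some-selected)) (cong₂ _+_ (length-tabulate some-selected) (length-tabulate _))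

  -- A row may select several of its places, and a slot may be filled without holding a true input.
  -- Both are harmless, as they can only raise the number of filled slots.
  Constraints : (Variable → Bool) → Set
  Constraints σ = SatCNF σ copying ×
    (∀ e e′ → σ (inj₁ (inj₂ e)) ≡ true → σ (inj₁ (inj₂ e′)) ≡ true → place e ≡ place e′ → e ≡ e′) ×
    countTrue (σ ∘ inj₂) ≤ k

  to : ∀ τ → (∃ λ ρ → ∃ λ ω → Constraints [ [ τ , ρ ] , ω ]) → AtMostK k τ
  to τ (ρ , ω , sat , inj , ω≤k) = ≤-trans (countTrue-injection τ ω _~_ stored ~-injective) ω≤k
    where
    σ = [ [ τ , ρ ] , ω ]
    _~_ : Fin n → Fin (r * b) → Set
    -- An input may be stored in several slots. If two inputs share one, place and column agree;
    -- injectivity of the selection then gives the same row, hence the same cell.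
    x ~ y = ∃ λ c → ρ (combine (row x) c) ≡ true × slot c x ≡ y
    sat-copied : ∀ x c → SatClause σ (copied x c)
    sat-copied x c = subst (λ p → SatClause σ (copied (proj₁ p) (proj₂ p))) (remQuot-combine x c)
      (All.tabulate⁻ (All.++⁻ʳ (tabulate some-selected) sat) (combine x c))
    stored : ∀ x → τ x ≡ true → ∃ λ y → ω y ≡ true × x ~ y
    stored x τx with Any.tabulate⁻ {f = selection x} (sat-neg⁻ σ (All.tabulate⁻ (All.++⁻ˡ (tabulate some-selected) sat) x) τx)
    ... | c , ρc = slot c x , sat-pos σ (sat-neg⁻ σ (sat-neg⁻ σ (sat-copied x c) τx) ρc) , c , ρc , refl
    ~-injective : ∀ {x x′ y} → x ~ y → x′ ~ y → x ≡ x′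
    ~-injective {x} {x′} (c , ρc , refl) (c′ , ρc′ , eq)
      with combine-injective (h (row x′) c′) (column x′) (h (row x) c) (column x) eq
    ... | same-place , same-column
      with combine-injective (row x) c (row x′) c′ (inj _ _ ρc ρc′
             (trans (place-combine (row x) c) (trans (sym same-place) (sym (place-combine (row x′) c′)))))
    ... | same-row , _ = cell-injective (trans (sym (combine-remQuot {l} b (cell x)))
             (trans (cong₂ combine same-row (sym same-column)) (combine-remQuot {l} b (cell x′))))

  from : ∀ τ → AtMostK k τ → ∃ λ ρ → ∃ λ ω → Constraints [ [ τ , ρ ] , ω ]
  from τ τ≤k = ρ , ω , All.++⁺ (All.tabulate⁺ sat-some) (All.tabulate⁺ sat-copied) , inj ,
    -- A filled slot is charged to a true input stored in it. The matching fixes one slot per input,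
    -- so no input is charged twice.
    ≤-trans (countTrue-injection ω τ (λ y x → slot (f (row x)) x ≡ y) ω-total (λ { refl eq → eq })) τ≤k
    where
    in-row? : ∀ i → Dec (∃ λ x → τ x ≡ true × row x ≡ i)
    in-row? i = any? λ x → τ x Bool.≟ true ×-dec row x ≟ i
    S : Fin l → Bool
    S i = does (in-row? i)
    S-elim : ∀ i → S i ≡ true → ∃ λ x → τ x ≡ true × row x ≡ i
    S-elim i e with in-row? i
    ... | yes w = w
    S-intro : ∀ x → τ x ≡ true → S (row x) ≡ true
    S-intro x τx = dec-true (in-row? (row x)) (x , τx , refl)
    S≤k : countTrue S ≤ k
    -- Each nonempty row contains a true input of its own, so expansion is needed only for sets of
    -- at most `k` rows.
    S≤k = ≤-trans (countTrue-injection S τ (λ i x → row x ≡ i) S-elim (λ { refl eq → eq })) τ≤k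
    hall : HallCondition S (λ _ → true)
    hall T T⊆S = ≤-trans (expands T (≤-trans (countTrue-⊆ T S T⊆S) S≤k))
      (countTrue-⊆ (N T) (N T ∩ (λ _ → true)) (λ v e → cong (_∧ true) e))
    S-matching : Matching S (λ _ → true)
    S-matching = matching _ S (λ _ → true) ≤-refl hall
    f = proj₁ S-matching
    f-injective = proj₂ (proj₂ S-matching)
    chosen : Fin l → Fin 3 → Bool
    chosen i c = S i ∧ ⁅ f i ⁆ c
    ρ : Fin (l * 3) → Bool
    ρ e = chosen (quotient 3 e) (remainder {l} 3 e)
    ρ-combine : ∀ i c → ρ (combine i c) ≡ chosen i c
    ρ-combine i c = cong (λ p → chosen (proj₁ p) (proj₂ p)) (remQuot-combine i c)
    filled? : ∀ y → Dec (∃ λ x → τ x ≡ true × slot (f (row x)) x ≡ y)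
    filled? y = any? λ x → τ x Bool.≟ true ×-dec slot (f (row x)) x ≟ y
    ω : Fin (r * b) → Bool
    ω y = does (filled? y)
    ω-total : ∀ y → ω y ≡ true → ∃ λ x → τ x ≡ true × slot (f (row x)) x ≡ y
    ω-total y e with filled? y
    ... | yes w = w
    σ = [ [ τ , ρ ] , ω ]
    sat-some : ∀ x → SatClause σ (some-selected x)
    sat-some x = sat-neg σ λ τx → Any.tabulate⁺ {f = selection x} (f (row x))
      (trans (ρ-combine (row x) (f (row x))) (cong₂ _∧_ (S-intro x τx) (⁅⁆-intro (f (row x)))))
    sat-copied : ∀ e → SatClause σ (copied (quotient 3 e) (remainder {n} 3 e))
    sat-copied e = sat-neg σ λ τx → sat-neg σ λ ρc → here (dec-true (filled? _) (x , τx ,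
      cong (λ c → slot c x) (sym (⁅⁆-elim (proj₂ (∧-elim {S (row x)} (trans (sym (ρ-combine (row x) _)) ρc)))))))
      where x = quotient 3 e
    inj : ∀ e e′ → ρ e ≡ true → ρ e′ ≡ true → place e ≡ place e′ → e ≡ e′
    inj e e′ s s′ eq = trans (sym (combine-remQuot {l} 3 e)) (trans (cong₂ combine same-row same-choice) (combine-remQuot {l} 3 e′))
      where
      i = quotient 3 e
      i′ = quotient 3 e′
      fi≡ : remainder {l} 3 e ≡ f i
      fi≡ = ⁅⁆-elim (proj₂ (∧-elim {S i} s))
      fi′≡ : remainder {l} 3 e′ ≡ f i′
      fi′≡ = ⁅⁆-elim (proj₂ (∧-elim {S i′} s′))
      same-row : i ≡ i′
      same-row = f-injective i i′ (proj₁ (∧-elim s)) (proj₁ (∧-elim s′))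
        (trans (cong (h i) (sym fi≡)) (trans eq (cong (h i′) fi′≡)))
      same-choice : remainder {l} 3 e ≡ remainder {l} 3 e′
      same-choice = trans fi≡ (trans (cong f same-row) (sym fi′≡))

  encoding : Encoding (l * 3 + (r * b + ((r + l * 3) + 2 * (r * b)))) ((n + n * 3) + (l * 3 * 3 + 7 * (r * b))) (AtMostK k)
  encoding = weaken ≤-refl (+-monoˡ-≤ _ (≤-reflexive size-copying)) to from
    (project (l * 3) (project (r * b)
      (conjunction (clauses copying) (conjunction (injective-on-true place (inj₁ ∘ inj₂)) (atMost k inj₂)))))

-- The cube root and the final bounds

countTrue≤n : (τ : Fin n → Bool) → countTrue τ ≤ n
countTrue≤n {zero}  τ = z≤n
countTrue≤n {suc n} τ with τ zero
... | true  = s≤s (countTrue≤n (τ ∘ suc))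
... | false = m≤n⇒m≤1+n (countTrue≤n (τ ∘ suc))

-- Here `b` is the integer part of the cube root of n / k, positive because k ≤ n. Increasing `n` by
-- one raises it by at most one.
cube-root : ∀ k n .{{_ : NonZero k}} → k ≤ n → ∃ λ b → NonZero b × k * b ^ 3 ≤ n × n < k * suc b ^ 3
cube-root (suc k) (suc n) k≤n with suc k ≤? n
... | no k≰n with refl ← ≤-antisym k≤n (≰⇒> k≰n) =
  1 , _ , ≤-reflexive (*-identityʳ (suc n)) , m<m*n (suc n) 8 (s≤s (s≤s z≤n))
... | yes k≤n′ with cube-root (suc k) n k≤n′
... | b , b≢0 , lower , upper with suc n <? suc k * suc b ^ 3
... | yes n< = b , b≢0 , m≤n⇒m≤1+n lower , n<
... | no  n≮ = suc b , _ , ≮⇒≥ n≮ , ≤-trans (s≤s upper) (*-monoʳ-< (suc k) (^-monoˡ-< 3 (n<1+n (suc b))))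

cube-≤ : ∀ C {x y z} → x ≤ C * y → y ^ 3 ≤ z → x ^ 3 ≤ C ^ 3 * z
cube-≤ C {x} {y} {z} x≤ y≤ = begin
  x ^ 3          ≤⟨ ^-monoˡ-≤ 3 x≤ ⟩
  (C * y) ^ 3    ≡⟨ ^-distribʳ-* 3 C y ⟩
  C ^ 3 * y ^ 3  ≤⟨ *-monoʳ-≤ (C ^ 3) y≤ ⟩
  C ^ 3 * z      ∎
  where open ≤-Reasoning

-- Both bounds are cubed to stay within the natural numbers. Truncated subtraction is faithful: if
-- `size φ` is at most `4 * n`, the bound on clauses holds anyway.
CubeBounded : (C n k : ℕ) → Set
CubeBounded C n k = Σ ℕ λ m → Σ (CNF (Var n m)) λ φ →
  Encodes φ (AtMostK k)
  × (size φ ∸ 4 * n) ^ 3 ≤ C ^ 3 * (k * n ^ 2)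
  × m ^ 3 ≤ C ^ 3 * (k * n ^ 2)

cube-bounded : ∀ C M {n k a c} → Encoding a c (AtMostK k {n}) →
  a ≤ C * M → c ≤ 4 * n + C * M → M ^ 3 ≤ k * n ^ 2 → CubeBounded C n k
cube-bounded C M {n} E a≤ c≤ M³≤ = aux E , formula E , encodes E ,
  cube-≤ C (m≤n+o⇒m∸n≤o (size (formula E)) (4 * n) (≤-trans (size≤ E) c≤)) M³≤ ,
  cube-≤ C (≤-trans (aux≤ E) a≤) M³≤

-- The constant is kept abstract so that its cube is never unfolded.
small-encoding : ∀ {C} → 184 ≤ C → ∀ n k .{{_ : NonZero n}} .{{_ : NonZero k}} → CubeBounded C n k
small-encoding {C} _ n k with k ≤? n
-- For k > n the constraint always holds and the empty formula encodes it.
... | no k≰n = cube-bounded C 0 (trivial (λ τ → ≤-trans (countTrue≤n τ) (≰⇒≥ k≰n))) z≤n z≤n z≤n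
small-encoding {C} 184≤C n k | yes k≤n with cube-root k n k≤n
... | b , b≢0 , lower , upper = cube-bounded C M (Grid.encoding h expands cell cell-injective) aux-bound size-bound M³≤
  where
  instance
    _ : NonZero b
    _ = b≢0
  open ≤-Reasoning
  open +-*-Solver
  M L R : ℕ
  M = k * (b * b)
  L = rows k b
  R = places k b
  h = proj₁ (hashing k b)
  expands = proj₂ (hashing k b)
  n≤cells : n ≤ L * b
  n≤cells = begin
    n                ≤⟨ <⇒≤ upper ⟩
    k * suc b ^ 3    ≤⟨ *-monoʳ-≤ k (^-monoˡ-≤ 3 (+-monoˡ-≤ b (>-nonZero⁻¹ b))) ⟩
    k * (b + b) ^ 3  ≡⟨ solve 2 (λ k b → k :* (b :+ b) :^ 3 := con 8 :* (k :* (b :* b)) :* b) refl k b ⟩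
    L * b            ∎
  cell : Fin n → Fin (L * b)
  cell x = inject≤ x n≤cells
  cell-injective : ∀ {x y} → cell x ≡ cell y → x ≡ y
  cell-injective = inject≤-injective n≤cells n≤cells _ _
  Rb≡ : R * b ≡ 16 * M
  Rb≡ = solve 2 (λ k b → con 16 :* (k :* b) :* b := con 16 :* (k :* (b :* b))) refl k b
  R≤ : R ≤ 16 * M
  R≤ = ≤-trans (m≤m*n R b) (≤-reflexive Rb≡)
  aux-bound : L * 3 + (R * b + ((R + L * 3) + 2 * (R * b))) ≤ C * M
  aux-bound = begin
    L * 3 + (R * b + ((R + L * 3) + 2 * (R * b)))
      ≡⟨ cong (λ x → L * 3 + (x + ((R + L * 3) + 2 * x))) Rb≡ ⟩
    L * 3 + (16 * M + ((R + L * 3) + 2 * (16 * M)))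
      ≤⟨ +-monoʳ-≤ (L * 3) (+-monoʳ-≤ (16 * M) (+-monoˡ-≤ (2 * (16 * M)) (+-monoˡ-≤ (L * 3) R≤))) ⟩
    L * 3 + (16 * M + ((16 * M + L * 3) + 2 * (16 * M)))
      ≡⟨ solve 1 (λ M → con 8 :* M :* con 3 :+ (con 16 :* M :+ ((con 16 :* M :+ con 8 :* M :* con 3) :+ con 2 :* (con 16 :* M)))
           := con 112 :* M) refl M ⟩
    112 * M
      ≤⟨ *-monoˡ-≤ M (m≤m+n 112 72) ⟩
    184 * M
      ≤⟨ *-monoˡ-≤ M 184≤C ⟩
    C * M ∎
  -- The constant is 184 = 72 + 112: the at-most-one chains take 3 clauses for each of the 3 * 8 * M
  -- selection variables, and the counter 7 for each of the 16 * M slots. It also covers the 112 * M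
  -- auxiliary variables.
  size-bound : (n + n * 3) + (L * 3 * 3 + 7 * (R * b)) ≤ 4 * n + C * M
  size-bound = begin
    (n + n * 3) + (L * 3 * 3 + 7 * (R * b))
      ≡⟨ cong (λ x → (n + n * 3) + (L * 3 * 3 + 7 * x)) Rb≡ ⟩
    (n + n * 3) + (L * 3 * 3 + 7 * (16 * M))
      ≡⟨ solve 2 (λ n M → (n :+ n :* con 3) :+ (con 8 :* M :* con 3 :* con 3 :+ con 7 :* (con 16 :* M))
           := con 4 :* n :+ con 184 :* M) refl n M ⟩
    4 * n + 184 * M
      ≤⟨ +-monoʳ-≤ (4 * n) (*-monoˡ-≤ M 184≤C) ⟩
    4 * n + C * M ∎
  M³≤ : M ^ 3 ≤ k * n ^ 2
  M³≤ = begin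
    M ^ 3
      ≡⟨ solve 2 (λ k b → (k :* (b :* b)) :^ 3 := k :* (k :* b :^ 3) :^ 2) refl k b ⟩
    k * (k * b ^ 3) ^ 2
      ≤⟨ *-monoʳ-≤ k (^-monoˡ-≤ 2 lower) ⟩
    k * n ^ 2 ∎

theorem3 : Σ ℕ λ C → (n k : ℕ) → .{{_ : NonZero n}} → .{{_ : NonZero k}} →
    Σ ℕ λ m → Σ (CNF (Var n m)) λ φ →
    Encodes φ (AtMostK k)
    × (size φ ∸ 4 * n) ^ 3 ≤ C ^ 3 * (k * n ^ 2)
    × m ^ 3 ≤ C ^ 3 * (k * n ^ 2)
theorem3 = 184 , λ n k → small-encoding ≤-refl n k
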